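{- Let $k$, $t$ and $\lambda$ be fixed positive integers such that $k \geq t+2$ and $t\geq 2$, and let $\alpha$ be a fixed positive constant such that \[ \alpha<\left(\frac{(k-1)(k-2)\cdots(k-t)}{\lambda(2^{t+1}-1)}\right)^{1/t}. \] Then for all sufficiently large $n$, every partial $(n,k,t)_\lambda$-system has a cyclically $\ell$-good sequencing for each positive integer $\ell \leq \alpha n^{1/t}$.
   Context: For positive integers $n,k,t,\lambda$ with $n \geq k > t \geq 2$, a partial $(n,k,t)_\lambda$-system is a pair $(X,\mathcal{B})$ where $X$ is an $n$-set of vertices and $\mathcal{B}$ is a collection of $k$-subsets of $X$ (blocks) such that each $t$-subset of $X$ is contained in at most $\lambda$ blocks. An independent set is a subset $Y\subseteq X$ containing no block. Let $\mathbb{Z}_n=\{0,\ldots,n-1\}$ be the cyclic group of order $n$. A sequencing is a bijection $\varphi:\mathbb{Z}_n\to X$. A set $S\subseteq X$ is cyclically consecutive if $S=\{\varphi(i),\varphi(i+1),\ldots,\varphi(i+|S|-1)\}$ for some $i\in\mathbb{Z}_n$ (addition in $\mathbb{Z}_n$). For a positive integer $\ell$, a sequencing is cyclically $\ell$-good if every set of $\ell$ cyclically consecutive vertices is an independent set. -}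

module Defs where

open import Data.Nat as ℕ using (ℕ; zero; suc; NonZero)
import Data.Nat.Properties as ℕₚ
open import Data.Nat.DivMod using (_mod_)
open import Data.Nat.ListAction using (product)
open import Data.Nat.ListAction.Properties using (product≢0)
open import Data.Integer as ℤ using (+_)
import Data.Integer.Properties as ℤₚ
open import Data.Nat.Coprimality using (1-coprimeTo) renaming (sym to coprime-sym)
open import Data.Rational as ℚ using (ℚ; 0ℚ; 1ℚ; Positive; mkℚ)
import Data.Rational.Properties as ℚₚ
open import Data.Rational.Solver using (module +-*-Solver)
open import Algebra.Definitions.RawSemiring ℚₚ.+-*-rawSemiring using (_^_) renaming (_×_ to _×ℚ_)
open import Data.Fin using (Fin; toℕ)
open import Data.Fin.Permutation using (Permutation′; _⟨$⟩ʳ_)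
open import Data.Fin.Subset using (Subset; ∣_∣; _∈_; _⊈_)
open import Data.Fin.Subset.Properties using (_⊆?_)
open import Data.List using (List; length; filter; applyUpTo)
open import Data.List.Relation.Unary.All using (All)
import Data.List.Relation.Unary.All.Properties as Allₚ
open import Data.Product using (_×_; _,_; ∃-syntax; proj₁; proj₂)
open import Data.Sum using (_⊎_; inj₁; inj₂; [_,_]′)
open import Function using (_⇔_; it)
open import Relation.Nullary using (¬_; contradiction)
open import Relation.Nullary.Decidable using (yes; no)
open import Relation.Binary.Definitions using (tri<; tri≈; tri>)
open import Relation.Binary.PropositionalEquality

-- Positive real numbers, as two-sided Dedekind cuts in ℚ. These are
-- the usual cuts, except that `positive` asks for a positive element of
-- the lower cut rather than just any element.

record ℝ⁺ : Set₁ where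
  field
    Lower Upper  : ℚ → Set
    positive     : ∃[ q ] 0ℚ ℚ.< q × Lower q
    bounded      : ∃[ q ] Upper q
    lower-closed : ∀ {p q} → p ℚ.< q → Lower q → Lower p
    lower-open   : ∀ {p} → Lower p → ∃[ q ] p ℚ.< q × Lower q
    upper-closed : ∀ {p q} → p ℚ.< q → Upper p → Upper q
    upper-open   : ∀ {q} → Upper q → ∃[ p ] p ℚ.< q × Upper p
    disjoint     : ∀ {q} → ¬ (Lower q × Upper q)
    located      : ∀ {p q} → p ℚ.< q → Lower p ⊎ Upper q

  lower<upper : ∀ {p q} → Lower p → Upper q → p ℚ.< q
  lower<upper {p} {q} lp uq with ℚₚ.<-cmp p q
  ... | tri< p<q _ _ = p<q
  ... | tri≈ _ refl _ = contradiction (lp , uq) disjoint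
  ... | tri> _ _ q<p = contradiction (lower-closed q<p lp , uq) disjoint

  upper⇒0< : ∀ {q} → Upper q → 0ℚ ℚ.< q
  upper⇒0< uq with positive
  ... | l , 0<l , ll = ℚₚ.<-trans 0<l (lower<upper ll uq)

  lower-≤ : ∀ {p q} → p ℚ.≤ q → Lower q → Lower p
  lower-≤ p≤q lq with lower-open lq
  ... | r , q<r , lr = lower-closed (ℚₚ.≤-<-trans p≤q q<r) lr

  upper-≤ : ∀ {p q} → p ℚ.≤ q → Upper p → Upper q
  upper-≤ p≤q up with upper-open up
  ... | r , r<p , ur = upper-closed (ℚₚ.<-≤-trans r<p p≤q) ur

open ℝ⁺ using (Lower; Upper)

infix 4 _≤ᴿ_ _<ᴿ_

_<ᴿ_ : ℝ⁺ → ℝ⁺ → Set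
x <ᴿ y = ∃[ q ] Upper x q × Lower y q

_≤ᴿ_ : ℝ⁺ → ℝ⁺ → Set
x ≤ᴿ y = ∀ q → Lower x q → Lower y q

p<p+1 : ∀ p → p ℚ.< p ℚ.+ 1ℚ
p<p+1 p = subst (ℚ._< p ℚ.+ 1ℚ) (ℚₚ.+-identityʳ p) (ℚₚ.+-monoʳ-< p (ℚₚ.positive⁻¹ 1ℚ))

fromℚ⁺ : (q : ℚ) → .{{Positive q}} → ℝ⁺
fromℚ⁺ q = record
  { Lower        = ℚ._< q
  ; Upper        = q ℚ.<_
  ; positive     = let r , 0<r , r<q = ℚₚ.<-dense (ℚₚ.positive⁻¹ q) in r , 0<r , r<q
  ; bounded      = q ℚ.+ 1ℚ , p<p+1 q
  ; lower-closed = ℚₚ.<-trans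
  ; lower-open   = λ p<q → ℚₚ.<-dense p<q
  ; upper-closed = λ p<r q<p → ℚₚ.<-trans q<p p<r
  ; upper-open   = λ q<p → let r , q<r , r<p = ℚₚ.<-dense q<p in r , r<p , q<r
  ; disjoint     = λ (p<q , q<p) → ℚₚ.<-asym p<q q<p
  ; located      = loc
  }
  where
  loc : ∀ {p r} → p ℚ.< r → p ℚ.< q ⊎ q ℚ.< r
  loc {p} p<r with p ℚₚ.<? q
  ... | yes p<q = inj₁ p<q
  ... | no  p≮q = inj₂ (ℚₚ.≤-<-trans (ℚₚ.≮⇒≥ p≮q) p<r)

_/ᴿ_ : (a b : ℕ) → .{{NonZero a}} → .{{NonZero b}} → ℝ⁺
(a /ᴿ b) = fromℚ⁺ (+ a ℚ./ b) {{ℚₚ.normalize-pos a b}}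

fromℕ⁺ : (n : ℕ) → .{{NonZero n}} → ℝ⁺
fromℕ⁺ n = n /ᴿ 1

*-mono-<-pos : ∀ {a b c d} → 0ℚ ℚ.< a → a ℚ.< b → 0ℚ ℚ.< c → c ℚ.< d → a ℚ.* c ℚ.< b ℚ.* d
*-mono-<-pos {a} {b} {c} {d} 0<a a<b 0<c c<d = ℚₚ.<-trans
  (ℚₚ.*-monoˡ-<-pos c {{ℚ.positive 0<c}} a<b)
  (ℚₚ.*-monoʳ-<-pos b {{ℚ.positive (ℚₚ.<-trans 0<a a<b)}} c<d)

*-pos : ∀ {a b} → 0ℚ ℚ.< a → 0ℚ ℚ.< b → 0ℚ ℚ.< a ℚ.* b
*-pos {a} {b} 0<a 0<b =
  subst (ℚ._< a ℚ.* b) (ℚₚ.*-zeroʳ a) (ℚₚ.*-monoʳ-<-pos a {{ℚ.positive 0<a}} 0<b)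


^-pos : ∀ {a} n → 0ℚ ℚ.< a → 0ℚ ℚ.< a ^ n
^-pos zero    0<a = ℚₚ.positive⁻¹ 1ℚ
^-pos (suc n) 0<a = *-pos 0<a (^-pos n 0<a)

^-mono-< : ∀ {a b} n → .{{NonZero n}} → 0ℚ ℚ.< a → a ℚ.< b → a ^ n ℚ.< b ^ n
^-mono-< {a} {b} (suc zero) 0<a a<b =
  subst₂ ℚ._<_ (sym (ℚₚ.*-identityʳ a)) (sym (ℚₚ.*-identityʳ b)) a<b
^-mono-< (suc (suc n)) 0<a a<b =
  *-mono-<-pos 0<a a<b (^-pos (suc n) 0<a) (^-mono-< (suc n) 0<a a<b)

^-≤1 : ∀ {a} n → 0ℚ ℚ.< a → a ℚ.≤ 1ℚ → a ^ n ℚ.≤ 1ℚ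
^-≤1 zero 0<a a≤1 = ℚₚ.≤-refl
^-≤1 {a} (suc n) 0<a a≤1 = ℚₚ.≤-trans
  (ℚₚ.*-monoˡ-≤-nonNeg a {{ℚ.nonNegative (ℚₚ.<⇒≤ 0<a)}} (^-≤1 n 0<a a≤1))
  (subst (ℚ._≤ 1ℚ) (sym (ℚₚ.*-identityʳ a)) a≤1)

^-≤-base : ∀ {a} n → .{{NonZero n}} → 0ℚ ℚ.< a → a ℚ.≤ 1ℚ → a ^ n ℚ.≤ a
^-≤-base {a} (suc n) 0<a a≤1 = subst (a ^ suc n ℚ.≤_) (ℚₚ.*-identityʳ a)
  (ℚₚ.*-monoˡ-≤-nonNeg a {{ℚ.nonNegative (ℚₚ.<⇒≤ 0<a)}} (^-≤1 n 0<a a≤1))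

1≤-^ : ∀ {a} n → 1ℚ ℚ.≤ a → 1ℚ ℚ.≤ a ^ n
1≤-^ zero 1≤a = ℚₚ.≤-refl
1≤-^ {a} (suc n) 1≤a = ℚₚ.≤-trans
  (subst (1ℚ ℚ.≤_) (sym (ℚₚ.*-identityʳ a)) 1≤a)
  (ℚₚ.*-monoˡ-≤-nonNeg a
    {{ℚ.nonNegative (ℚₚ.≤-trans (ℚₚ.<⇒≤ (ℚₚ.positive⁻¹ 1ℚ)) 1≤a)}} (1≤-^ n 1≤a))

base-≤-^ : ∀ {a} n → .{{NonZero n}} → 1ℚ ℚ.≤ a → a ℚ.≤ a ^ n
base-≤-^ {a} (suc n) 1≤a = subst (ℚ._≤ a ^ suc n) (ℚₚ.*-identityʳ a)
  (ℚₚ.*-monoˡ-≤-nonNeg a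
    {{ℚ.nonNegative (ℚₚ.≤-trans (ℚₚ.<⇒≤ (ℚₚ.positive⁻¹ 1ℚ)) 1≤a)}} (1≤-^ n 1≤a))

-- A rational lies below the n-th root of x when some positive a above
-- it has aⁿ < x; asking for a keeps the lower cut downward closed in ℚ.

infixr 8 _^1/_

_^1/_ : ℝ⁺ → (n : ℕ) → .{{NonZero n}} → ℝ⁺
x ^1/ n = record
  { Lower        = L
  ; Upper        = U
  ; positive     = pos
  ; bounded      = bnd
  ; lower-closed = λ p<q (a , 0<a , q<a , l) → a , 0<a , ℚₚ.<-trans p<q q<a , l
  ; lower-open   = λ (a , 0<a , p<a , l) →
      let r , p<r , r<a = ℚₚ.<-dense p<a in r , p<r , a , 0<a , r<a , l
  ; upper-closed = λ p<q (a , 0<a , a<p , u) → a , 0<a , ℚₚ.<-trans a<p p<q , u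
  ; upper-open   = λ (a , 0<a , a<p , u) →
      let r , a<r , r<p = ℚₚ.<-dense a<p in r , r<p , a , 0<a , a<r , u
  ; disjoint     = λ ((a , _ , q<a , l) , (b , 0<b , b<q , u)) →
      ℚₚ.<-asym (^-mono-< n 0<b (ℚₚ.<-trans b<q q<a)) (x.lower<upper l u)
  ; located      = loc
  }
  where
  module x = ℝ⁺ x

  L U : ℚ → Set
  L q = ∃[ a ] 0ℚ ℚ.< a × q ℚ.< a × Lower x (a ^ n)
  U q = ∃[ a ] 0ℚ ℚ.< a × a ℚ.< q × Upper x (a ^ n)

  pos : ∃[ q ] 0ℚ ℚ.< q × L q
  pos with x.positive
  ... | l , 0<l , ll with ℚₚ.≤-total l 1ℚ
  ...   | inj₁ l≤1 = let r , 0<r , r<l = ℚₚ.<-dense 0<l in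
          r , 0<r , l , 0<l , r<l , x.lower-≤ (^-≤-base n 0<l l≤1) ll
  ...   | inj₂ 1≤l = let 0<1 = ℚₚ.positive⁻¹ 1ℚ ; r , 0<r , r<1 = ℚₚ.<-dense 0<1 in
          r , 0<r , 1ℚ , 0<1 , r<1 ,
          x.lower-≤ (ℚₚ.≤-trans (^-≤-base n 0<1 ℚₚ.≤-refl) 1≤l) ll

  bnd : ∃[ q ] U q
  bnd with x.bounded
  ... | u , uu with ℚₚ.≤-total u 1ℚ
  ...   | inj₁ u≤1 = 1ℚ ℚ.+ 1ℚ , 1ℚ , ℚₚ.positive⁻¹ 1ℚ , p<p+1 1ℚ ,
          x.upper-≤ (ℚₚ.≤-trans u≤1 (base-≤-^ n ℚₚ.≤-refl)) uu
  ...   | inj₂ 1≤u = u ℚ.+ 1ℚ , u , x.upper⇒0< uu , p<p+1 u , x.upper-≤ (base-≤-^ n 1≤u) uu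

  loc : ∀ {p q} → p ℚ.< q → L p ⊎ U q
  loc {p} p<q with 0ℚ ℚₚ.<? p
  ... | no 0≮p = let r , 0<r , a , 0<a , r<a , l = pos in
        inj₁ (a , 0<a , ℚₚ.≤-<-trans (ℚₚ.≮⇒≥ 0≮p) 0<a , l)
  ... | yes 0<p with ℚₚ.<-dense p<q
  ...   | a , p<a , a<q with ℚₚ.<-dense a<q
  ...     | b , a<b , b<q
            with x.located (^-mono-< n (ℚₚ.<-trans 0<p p<a) a<b)
  ...       | inj₁ l = inj₁ (a , ℚₚ.<-trans 0<p p<a , p<a , l)
  ...       | inj₂ u = inj₂ (b , ℚₚ.<-trans 0<p (ℚₚ.<-trans p<a a<b) , b<q , u)

_/1 : ℕ → ℚ
n /1 = mkℚ (+ n) 0 (coprime-sym (1-coprimeTo n))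

1+n/1 : ∀ n → 1ℚ ℚ.+ n /1 ≡ suc n /1
1+n/1 n = trans
  (cong (λ i → (+ 1 ℤ.+ i) ℚ./ 1) (ℤₚ.*-identityʳ (+ n)))
  (ℚₚ.↥p/↧p≡p (suc n /1))

n×1≡n/1 : ∀ n → n ×ℚ 1ℚ ≡ n /1
n×1≡n/1 zero    = refl
n×1≡n/1 (suc n) = trans (cong (1ℚ ℚ.+_) (n×1≡n/1 n)) (1+n/1 n)

×ℚ-*-assoc : ∀ n e → (n ×ℚ 1ℚ) ℚ.* e ≡ n ×ℚ e
×ℚ-*-assoc zero    e = ℚₚ.*-zeroˡ e
×ℚ-*-assoc (suc n) e = trans (ℚₚ.*-distribʳ-+ e 1ℚ (n ×ℚ 1ℚ))
  (cong₂ ℚ._+_ (ℚₚ.*-identityˡ e) (×ℚ-*-assoc n e))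

<-suc/1 : ∀ r → ∃[ n ] r ℚ.< n /1
<-suc/1 (mkℚ i d _) = suc ℤ.∣ i ∣ , ℚ.*<* (begin-strict
  i ℤ.* + 1                    ≡⟨ ℤₚ.*-identityʳ i ⟩
  i                            ≤⟨ i≤∣i∣ i ⟩
  + ℤ.∣ i ∣                    <⟨ ℤ.+<+ (ℕₚ.n<1+n ℤ.∣ i ∣) ⟩
  + suc ℤ.∣ i ∣                ≤⟨ ℤ.+≤+ (ℕₚ.m≤m*n (suc ℤ.∣ i ∣) (suc d)) ⟩
  + (suc ℤ.∣ i ∣ ℕ.* suc d)    ≡⟨ ℤₚ.pos-* (suc ℤ.∣ i ∣) (suc d) ⟩
  + suc ℤ.∣ i ∣ ℤ.* + suc d    ∎)
  where
  open ℤₚ.≤-Reasoning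
  i≤∣i∣ : ∀ i → i ℤ.≤ + ℤ.∣ i ∣
  i≤∣i∣ (+ n)        = ℤₚ.≤-refl
  i≤∣i∣ ℤ.-[1+ n ]   = ℤ.-≤+

archimedean : ∀ r {e} → 0ℚ ℚ.< e → ∃[ n ] r ℚ.< n ×ℚ e
archimedean r {e} 0<e = n , subst₂ ℚ._<_ r/e*e≡r (×ℚ-*-assoc n e)
  (ℚₚ.*-monoˡ-<-pos e {{ℚ.positive 0<e}} (subst (r ℚ.* ℚ.1/ e ℚ.<_) (sym (n×1≡n/1 n)) r/e<n))
  where
  instance
    e≢0 : ℚ.NonZero e
    e≢0 = ℚ.>-nonZero 0<e
  n,p = <-suc/1 (r ℚ.* ℚ.1/ e)
  n = proj₁ n,p
  r/e<n = proj₂ n,p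
  r/e*e≡r : (r ℚ.* ℚ.1/ e) ℚ.* e ≡ r
  r/e*e≡r = trans (ℚₚ.*-assoc r (ℚ.1/ e) e)
    (trans (cong (r ℚ.*_) (ℚₚ.*-inverseˡ e)) (ℚₚ.*-identityʳ r))

-- Consecutive multiples of e contain a lower and an upper element that
-- differ by at most 2 e.
narrow : (x : ℝ⁺) → ∀ {e} → 0ℚ ℚ.< e → ∀ n {p} →
         Lower x p → Upper x (p ℚ.+ n ×ℚ e) →
         ∃[ l ] p ℚ.≤ l × Lower x l × Upper x (l ℚ.+ (e ℚ.+ e))
narrow x 0<e zero {p} lp up =
  contradiction (lp , subst (Upper x) (ℚₚ.+-identityʳ p) up) (ℝ⁺.disjoint x)
narrow x {e} 0<e (suc n) {p} lp up
  with ℝ⁺.located x (ℚₚ.+-monoʳ-< p (p<e+p e))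
  where
  p<e+p : ∀ p → p ℚ.< p ℚ.+ e
  p<e+p p = subst (ℚ._< p ℚ.+ e) (ℚₚ.+-identityʳ p) (ℚₚ.+-monoʳ-< p 0<e)
... | inj₂ u = p , ℚₚ.≤-refl , lp , u
... | inj₁ l with narrow x 0<e n l (subst (Upper x) (sym (ℚₚ.+-assoc p e (n ×ℚ e))) up)
...   | q , p+e≤q , lq , uq = q , ℚₚ.≤-trans p≤p+e p+e≤q , lq , uq
  where
  p≤p+e : p ℚ.≤ p ℚ.+ e
  p≤p+e = subst (ℚ._≤ p ℚ.+ e) (ℚₚ.+-identityʳ p) (ℚₚ.+-monoʳ-≤ p (ℚₚ.<⇒≤ 0<e))

ratio : (x : ℝ⁺) → ∀ {c d} → 0ℚ ℚ.< c → c ℚ.< d →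
        ∃[ l ] ∃[ u ] 0ℚ ℚ.< l × Lower x l × Upper x u × c ℚ.* u ℚ.< d ℚ.* l
ratio x {c} {d} 0<c c<d
  with ℝ⁺.positive x | ℝ⁺.bounded x
... | l₀ , 0<l₀ , ll₀ | u₀ , uu₀
    with ℚₚ.<-dense (*-pos 0<d-c 0<l₀)
  where
  0<d-c : 0ℚ ℚ.< d ℚ.- c
  0<d-c = subst (ℚ._< d ℚ.- c) (ℚₚ.+-inverseʳ c) (ℚₚ.+-monoˡ-< (ℚ.- c) c<d)
... | e , 0<e , e<k = l , l ℚ.+ (ε ℚ.+ ε) , ℚₚ.<-≤-trans 0<l₀ l₀≤l , ll , ul , cu<dl
  where
  open +-*-Solver
  0<2c : 0ℚ ℚ.< c ℚ.+ c
  0<2c = ℚₚ.+-mono-< 0<c 0<c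
  instance
    2c-pos : Positive (c ℚ.+ c)
    2c-pos = ℚ.positive 0<2c
    2c≢0 : ℚ.NonZero (c ℚ.+ c)
    2c≢0 = ℚₚ.pos⇒nonZero (c ℚ.+ c)
  ε : ℚ
  ε = e ℚ.* ℚ.1/ (c ℚ.+ c)
  0<ε : 0ℚ ℚ.< ε
  0<ε = *-pos 0<e (ℚₚ.positive⁻¹ (ℚ.1/ (c ℚ.+ c)) {{ℚₚ.1/pos⇒pos (c ℚ.+ c)}})
  c*2ε : c ℚ.* (ε ℚ.+ ε) ≡ e
  c*2ε = trans
    (solve 3 (λ c e i → c :* (e :* i :+ e :* i) := e :* ((c :+ c) :* i)) refl c e (ℚ.1/ (c ℚ.+ c)))
    (trans (cong (e ℚ.*_) (ℚₚ.*-inverseʳ (c ℚ.+ c))) (ℚₚ.*-identityʳ e))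
  n,p = archimedean u₀ 0<ε
  n = proj₁ n,p
  u₀<l₀+nε : u₀ ℚ.< l₀ ℚ.+ n ×ℚ ε
  u₀<l₀+nε = subst (ℚ._< l₀ ℚ.+ n ×ℚ ε) (ℚₚ.+-identityˡ u₀)
    (ℚₚ.+-mono-< 0<l₀ (proj₂ n,p))
  nar = narrow x 0<ε n ll₀ (ℝ⁺.upper-closed x u₀<l₀+nε uu₀)
  l = proj₁ nar
  l₀≤l = proj₁ (proj₂ nar)
  ll = proj₁ (proj₂ (proj₂ nar))
  ul = proj₂ (proj₂ (proj₂ nar))
  cu<dl : c ℚ.* (l ℚ.+ (ε ℚ.+ ε)) ℚ.< d ℚ.* l
  cu<dl = begin-strict
    c ℚ.* (l ℚ.+ (ε ℚ.+ ε))          ≡⟨ ℚₚ.*-distribˡ-+ c l (ε ℚ.+ ε) ⟩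
    c ℚ.* l ℚ.+ c ℚ.* (ε ℚ.+ ε)      ≡⟨ cong (c ℚ.* l ℚ.+_) c*2ε ⟩
    c ℚ.* l ℚ.+ e                    <⟨ ℚₚ.+-monoʳ-< (c ℚ.* l) e<k ⟩
    c ℚ.* l ℚ.+ (d ℚ.- c) ℚ.* l₀     ≤⟨ ℚₚ.+-monoʳ-≤ (c ℚ.* l) (ℚₚ.*-monoˡ-≤-nonNeg (d ℚ.- c)
                                          {{ℚ.nonNegative 0≤d-c}} l₀≤l) ⟩
    c ℚ.* l ℚ.+ (d ℚ.- c) ℚ.* l      ≡⟨ solve 3 (λ c d l → c :* l :+ (d :- c) :* l := d :* l) refl c d l ⟩
    d ℚ.* l                          ∎
    where
    open ℚₚ.≤-Reasoning
    0≤d-c : 0ℚ ℚ.≤ d ℚ.- c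
    0≤d-c = subst (ℚ._≤ d ℚ.- c) (ℚₚ.+-inverseʳ c) (ℚₚ.+-monoˡ-≤ (ℚ.- c) (ℚₚ.<⇒≤ c<d))

quotients : ∀ {c d l u} → 0ℚ ℚ.< l → 0ℚ ℚ.< u → c ℚ.* u ℚ.< d ℚ.* l →
            ∃[ s ] ∃[ t ] s ℚ.< t × s ℚ.* l ≡ c × t ℚ.* u ≡ d
quotients {c} {d} {l} {u} 0<l 0<u cu<dl =
  s , t , ℚₚ.*-cancelʳ-<-nonNeg (l ℚ.* u) {{ℚ.nonNegative (ℚₚ.<⇒≤ (*-pos 0<l 0<u))}} slu<tlu ,
  sl≡c , tu≡d
  where
  open +-*-Solver
  instance
    l≢0 : ℚ.NonZero l
    l≢0 = ℚ.>-nonZero 0<l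
    u≢0 : ℚ.NonZero u
    u≢0 = ℚ.>-nonZero 0<u
  s t : ℚ
  s = c ℚ.* ℚ.1/ l
  t = d ℚ.* ℚ.1/ u
  sl≡c : s ℚ.* l ≡ c
  sl≡c = trans (ℚₚ.*-assoc c (ℚ.1/ l) l)
    (trans (cong (c ℚ.*_) (ℚₚ.*-inverseˡ l)) (ℚₚ.*-identityʳ c))
  tu≡d : t ℚ.* u ≡ d
  tu≡d = trans (ℚₚ.*-assoc d (ℚ.1/ u) u)
    (trans (cong (d ℚ.*_) (ℚₚ.*-inverseˡ u)) (ℚₚ.*-identityʳ d))
  slu<tlu : s ℚ.* (l ℚ.* u) ℚ.< t ℚ.* (l ℚ.* u)
  slu<tlu = subst₂ ℚ._<_
    (trans (cong (ℚ._* u) (sym sl≡c)) (ℚₚ.*-assoc s l u))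
    (trans (cong (ℚ._* l) (sym tu≡d))
      (solve 3 (λ t u l → (t :* u) :* l := t :* (l :* u)) refl t u l))
    cu<dl

infixl 7 _*ᴿ_

_*ᴿ_ : ℝ⁺ → ℝ⁺ → ℝ⁺
x *ᴿ y = record
  { Lower        = L
  ; Upper        = U
  ; positive     = pos
  ; bounded      = bnd
  ; lower-closed = λ p<q (a , b , 0<a , 0<b , la , lb , q<ab) →
      a , b , 0<a , 0<b , la , lb , ℚₚ.<-trans p<q q<ab
  ; lower-open   = lopen
  ; upper-closed = λ p<q (a , b , ua , ub , ab<p) → a , b , ua , ub , ℚₚ.<-trans ab<p p<q
  ; upper-open   = uopen
  ; disjoint     = disj
  ; located      = loc
  }
  where
  module x = ℝ⁺ x
  module y = ℝ⁺ y

  L U : ℚ → Set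
  L q = ∃[ a ] ∃[ b ] 0ℚ ℚ.< a × 0ℚ ℚ.< b × Lower x a × Lower y b × q ℚ.< a ℚ.* b
  U q = ∃[ a ] ∃[ b ] Upper x a × Upper y b × a ℚ.* b ℚ.< q

  bnd : ∃[ q ] U q
  bnd with x.bounded | y.bounded
  ... | a , ua | b , ub = a ℚ.* b ℚ.+ 1ℚ , a , b , ua , ub , p<p+1 (a ℚ.* b)

  lopen : ∀ {p} → L p → ∃[ q ] p ℚ.< q × L q
  lopen (a , b , 0<a , 0<b , la , lb , p<ab) with ℚₚ.<-dense p<ab
  ... | r , p<r , r<ab = r , p<r , a , b , 0<a , 0<b , la , lb , r<ab

  uopen : ∀ {q} → U q → ∃[ p ] p ℚ.< q × U p
  uopen (a , b , ua , ub , ab<q) with ℚₚ.<-dense ab<q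
  ... | r , ab<r , r<q = r , r<q , a , b , ua , ub , ab<r

  disj : ∀ {q} → ¬ (L q × U q)
  disj {q} ((a , b , 0<a , 0<b , la , lb , q<ab) , (a′ , b′ , ua , ub , ab<q)) =
    ℚₚ.<-asym {a ℚ.* b} {a′ ℚ.* b′}
      (*-mono-<-pos {a} {a′} {b} {b′} 0<a (x.lower<upper la ua) 0<b (y.lower<upper lb ub))
      (ℚₚ.<-trans {a′ ℚ.* b′} {q} {a ℚ.* b} ab<q q<ab)

  pos : ∃[ q ] 0ℚ ℚ.< q × L q
  pos with x.positive | y.positive
  ... | a , 0<a , la | b , 0<b , lb with ℚₚ.<-dense (*-pos 0<a 0<b)
  ...   | r , 0<r , r<ab = r , 0<r , a , b , 0<a , 0<b , la , lb , r<ab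

  scaled : ∀ {p q c d} → 0ℚ ℚ.< p → p ℚ.< c → d ℚ.< q →
           ∃[ l ] ∃[ u ] 0ℚ ℚ.< l × Lower y l × Upper y u × c ℚ.* u ℚ.< d ℚ.* l → L p ⊎ U q
  scaled {p} {q} {c} {d} 0<p p<c d<q (l , u , 0<l , ll , uu , cu<dl) =
    decide (quotients {c} {d} {l} {u} 0<l (y.upper⇒0< uu) cu<dl)
    where
    decide : ∃[ s ] ∃[ t ] s ℚ.< t × s ℚ.* l ≡ c × t ℚ.* u ≡ d → L p ⊎ U q
    decide (s , t , s<t , sl≡c , tu≡d) = [ below , above ]′ (x.located s<t)
      where
      0<s : 0ℚ ℚ.< s
      0<s = ℚₚ.*-cancelʳ-<-nonNeg l {{ℚ.nonNegative (ℚₚ.<⇒≤ 0<l)}} {0ℚ} {s}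
        (subst₂ ℚ._<_ (sym (ℚₚ.*-zeroˡ l)) (sym sl≡c) (ℚₚ.<-trans 0<p p<c))

      below : Lower x s → L p ⊎ U q
      below ls = inj₁ (s , l , 0<s , 0<l , ls , ll , subst (p ℚ.<_) (sym sl≡c) p<c)

      above : Upper x t → L p ⊎ U q
      above ut = inj₂ (t , u , ut , uu , subst (ℚ._< q) (sym tu≡d) d<q)

  loc : ∀ {p q} → p ℚ.< q → L p ⊎ U q
  loc {p} {q} p<q with 0ℚ ℚₚ.<? p
  ... | no 0≮p = inj₁ (nonpos pos)
    where
    nonpos : ∃[ r ] 0ℚ ℚ.< r × L r → L p
    nonpos (r , 0<r , a , b , 0<a , 0<b , la , lb , r<ab) =
      a , b , 0<a , 0<b , la , lb , ℚₚ.≤-<-trans (ℚₚ.≮⇒≥ 0≮p) (ℚₚ.<-trans 0<r r<ab)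
  ... | yes 0<p with ℚₚ.<-dense p<q
  ...   | c , p<c , c<q with ℚₚ.<-dense c<q
  ...     | d , c<d , d<q = scaled 0<p p<c d<q (ratio y (ℚₚ.<-trans 0<p p<c) c<d)

-- ((k − 1)(k − 2)⋯(k − t)) / (lam (2ᵗ⁺¹ − 1)). The hypothesis makes every
-- factor positive, so no truncated subtraction is actually truncated.

threshold : (k t lam : ℕ) → .{{NonZero lam}} → t ℕ.+ 2 ℕ.≤ k → ℝ⁺
threshold k t lam t+2≤k =
  (product (applyUpTo (λ i → k ℕ.∸ suc i) t) /ᴿ (lam ℕ.* (2 ℕ.^ (t ℕ.+ 1) ℕ.∸ 1)))
    {{numerator≢0}} {{denominator≢0}}
  where
  factor≢0 : ∀ {i} → i ℕ.< t → NonZero (k ℕ.∸ suc i)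
  factor≢0 i<t = ℕ.>-nonZero (ℕₚ.m<n⇒0<n∸m
    (ℕₚ.≤-trans (ℕ.s≤s i<t) (ℕₚ.≤-trans (ℕₚ.≤-trans (ℕₚ.n≤1+n (suc t)) (ℕₚ.≤-reflexive (ℕₚ.+-comm 2 t))) t+2≤k)))

  numerator≢0 : NonZero (product (applyUpTo (λ i → k ℕ.∸ suc i) t))
  numerator≢0 = product≢0 (Allₚ.applyUpTo⁺₁ (λ i → k ℕ.∸ suc i) t factor≢0)

  denominator≢0 : NonZero (lam ℕ.* (2 ℕ.^ (t ℕ.+ 1) ℕ.∸ 1))
  denominator≢0 = ℕₚ.m*n≢0 lam _ {{it}} {{ℕ.>-nonZero (ℕₚ.m<n⇒0<n∸m
    (ℕₚ.<-≤-trans (ℕ.s≤s (ℕ.s≤s ℕ.z≤n)) (ℕₚ.^-monoʳ-≤ 2 (ℕₚ.m≤n+m 1 t))))}}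

-- The vertex set is Fin n. Blocks form a list, so repeated blocks are
-- allowed and count with multiplicity towards lam.

record PartialSystem (n k t lam : ℕ) : Set where
  field
    k≤n        : k ℕ.≤ n
    t<k        : t ℕ.< k
    2≤t        : 2 ℕ.≤ t
    blocks     : List (Subset n)
    block-size : All (λ B → ∣ B ∣ ≡ k) blocks
    balance    : (T : Subset n) → ∣ T ∣ ≡ t → length (filter (T ⊆?_) blocks) ℕ.≤ lam

Sequencing : ℕ → Set
Sequencing = Permutation′

Independent : ∀ {n k t lam} → PartialSystem n k t lam → Subset n → Set
Independent S Y = All (_⊈ Y) (PartialSystem.blocks S)

CyclicallyConsecutive : ∀ {n} → .{{NonZero n}} → Sequencing n → Subset n → Set
CyclicallyConsecutive {n} φ S =
  ∃[ i ] (∀ x → x ∈ S ⇔ (∃[ j ] j ℕ.< ∣ S ∣ × x ≡ φ ⟨$⟩ʳ ((toℕ {n} i ℕ.+ j) mod n)))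

-- Vacuous for ℓ > n, as no subset of Fin n then has ℓ elements.

CyclicallyGood : ∀ {n k t lam} → .{{NonZero n}} →
                 PartialSystem n k t lam → ℕ → Sequencing n → Set
CyclicallyGood {n} S ℓ φ =
  (Y : Subset n) → ∣ Y ∣ ≡ ℓ → CyclicallyConsecutive φ Y → Independent S Y

{-# OPTIONS --safe #-}
module Submission where

-- Distribute the vertices over M ≈ n / 4ℓ cyclically arranged colour classes, each of size at
-- least ℓ, so that no block lies in a range, i.e. in the union of two consecutive classes.
-- Listing the classes one after the other then gives a good sequencing, since ℓ consecutive
-- vertices never leave a range.
--
-- Vertices are coloured one at a time. A colour is forbidden for an uncoloured vertex x if some
-- block through x has its k − 1 other points in a range of that colour; call the number of such
-- pairs (block, range) the danger of x, and consider also the number of pairs in which at least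
-- k − 2 other points lie in the range. As k − 3 ≥ t − 1, colouring one vertex creates only
-- O(ℓᵗ⁻¹) = O(M) pairs of the second kind, and a colour that is good on average creates few pairs
-- of the first kind. Always colour a vertex x of largest weight, a combination of the two counts.
-- As in the box game, a set J of uncoloured vertices then has at most the average weight that
-- J ∪ {x} had before, plus the share of the growth in this step. Hence all weights stay within a
-- factor O(log n) of the growth per step, and the danger of every vertex stays below M / 8 as soon
-- as M exceeds a multiple of log² n.
-- To make every class large, these steps alternate at first with steps which, for a prescribed
-- colour, pick a vertex that is good on average.

open import Defs
open import Data.Nat using (ℕ; zero; suc; NonZero; _≤_; _<_; _+_; _*_; _^_; _∸_; z≤n; s≤s; _≤ᵇ_; >-nonZero; >-nonZero⁻¹)
import Data.Nat.Properties as ℕₚ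
open import Data.Nat.DivMod
open import Data.Nat.ListAction using (sum)
open import Data.Nat.ListAction.Properties using (sum-↭)
open import Data.Nat.Tactic.RingSolver using (solve-∀)
import Data.Integer as ℤ
import Data.Integer.Properties as ℤₚ
open import Data.Rational as ℚ using (ℚ; 0ℚ; 1ℚ)
import Data.Rational.Properties as ℚₚ
open import Algebra.Bundles using (CommutativeRing)
open import Algebra.Definitions.RawSemiring ℚₚ.+-*-rawSemiring using () renaming (_^_ to _^ℚ_)
import Algebra.Properties.CommutativeSemiring.Exp as Exp
open import Data.Bool using (Bool; true; false; T; _∨_; T?)
open import Data.Bool.Properties using (∨-zeroʳ)
open import Data.Unit using (⊤)
open import Data.Fin as Fin using (Fin)
import Data.Fin.Properties as Finₚ
open import Data.Fin.Permutation using (permutation; _⟨$⟩ʳ_)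
open import Data.Fin.Subset using (Subset; ∣_∣; _⊆_; _∪_; ⁅_⁆; ⊥) renaming (_∈_ to _∈ₛ_; _∉_ to _∉ₛ_)
import Data.Fin.Subset.Properties as Sub
open import Data.Vec as Vec using ([]; _∷_; lookup)
open import Data.Vec.Properties using ([]=⇒lookup; lookup⇒[]=)
open import Data.List as List using (List; []; _∷_; _++_; map; length; filter; tabulate; allFin; take; drop; concatMap)
import Data.List.Properties as Listₚ
open import Data.List.Membership.Propositional using (_∈_; _∉_)
open import Data.List.Membership.Propositional.Properties
  using (∈-∃++; ∈-allFin; ∈-map⁺; ∈-map⁻; ∈-filter⁻; ∈-++⁺ˡ; ∈-++⁺ʳ; ∈-lookup)
open import Data.List.Relation.Unary.Any using (here; there; index)
open import Data.List.Relation.Unary.Any.Properties using (lookup-index)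
open import Data.List.Relation.Unary.All as All using (All; []; _∷_)
import Data.List.Relation.Unary.All.Properties as Allₚ
open import Data.List.Relation.Unary.AllPairs using ([]; _∷_)
import Data.List.Relation.Unary.AllPairs.Properties as AllPairsₚ
open import Data.List.Relation.Unary.Unique.Propositional using (Unique)
import Data.List.Relation.Unary.Unique.Propositional.Properties as Uniqueₚ
open import Data.List.Relation.Binary.Permutation.Propositional
  using (_↭_; ↭-sym; ↭-trans; ↭-reflexive; prep; ↭⇒↭ₛ)
import Data.List.Relation.Binary.Permutation.Propositional.Properties as Perm
import Data.List.Relation.Binary.Permutation.Setoid.Properties as Permₛ
open import Data.Product using (_×_; _,_; ∃-syntax; proj₁; proj₂)
open import Data.Sum using (inj₁; inj₂)
open import Function using (_∘_; id; it; Equivalence)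
open import Level using (0ℓ)
open import Relation.Nullary using (yes; no; does; contradiction)
open import Relation.Nullary.Decidable using (toWitness)
open import Relation.Unary using (Pred; Decidable)
open import Relation.Binary.PropositionalEquality

-- Finite sums over lists, averaging and permutations

private
  variable
    X Y : Set

∑ : List X → (X → ℕ) → ℕ
∑ xs f = sum (map f xs)

∑-mono : ∀ (xs : List X) {f g} → (∀ {x} → x ∈ xs → f x ≤ g x) → ∑ xs f ≤ ∑ xs g
∑-mono []       f≤g = z≤n
∑-mono (x ∷ xs) f≤g = ℕₚ.+-mono-≤ (f≤g (here refl)) (∑-mono xs (f≤g ∘ there))

∑-cong : ∀ (xs : List X) {f g} → (∀ x → f x ≡ g x) → ∑ xs f ≡ ∑ xs g
∑-cong xs f≗g = cong sum (Listₚ.map-cong f≗g xs)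

∑-+ : ∀ (xs : List X) f g → ∑ xs (λ x → f x + g x) ≡ ∑ xs f + ∑ xs g
∑-+ []       f g = refl
∑-+ (x ∷ xs) f g = trans (cong (f x + g x +_) (∑-+ xs f g)) (lemma (f x) (g x) (∑ xs f) (∑ xs g))
  where
  lemma : ∀ a b c d → a + b + (c + d) ≡ a + c + (b + d)
  lemma = solve-∀

∑-*ˡ : ∀ (xs : List X) c f → ∑ xs (λ x → c * f x) ≡ c * ∑ xs f
∑-*ˡ []       c f = sym (ℕₚ.*-zeroʳ c)
∑-*ˡ (x ∷ xs) c f = trans (cong (c * f x +_) (∑-*ˡ xs c f)) (sym (ℕₚ.*-distribˡ-+ c (f x) (∑ xs f)))

∑-*ʳ : ∀ (xs : List X) f c → ∑ xs (λ x → f x * c) ≡ ∑ xs f * c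
∑-*ʳ xs f c = trans (∑-cong xs (λ x → ℕₚ.*-comm (f x) c)) (trans (∑-*ˡ xs c f) (ℕₚ.*-comm c (∑ xs f)))

∑-const : ∀ (xs : List X) c → ∑ xs (λ _ → c) ≡ length xs * c
∑-const []       c = refl
∑-const (x ∷ xs) c = cong (c +_) (∑-const xs c)

∑-swap : ∀ (xs : List X) (ys : List Y) (f : X → Y → ℕ) →
         ∑ xs (λ x → ∑ ys (f x)) ≡ ∑ ys (λ y → ∑ xs (λ x → f x y))
∑-swap []       ys f = sym (trans (∑-const ys 0) (ℕₚ.*-zeroʳ (length ys)))
∑-swap (x ∷ xs) ys f = trans (cong (∑ ys (f x) +_) (∑-swap xs ys f))
  (sym (∑-+ ys (f x) (λ y → ∑ xs (λ x → f x y))))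

∑-↭ : ∀ {xs ys : List X} f → xs ↭ ys → ∑ xs f ≡ ∑ ys f
∑-↭ f xs↭ys = sum-↭ (Perm.map⁺ f xs↭ys)

∑-map : ∀ (h : X → Y) xs f → ∑ (map h xs) f ≡ ∑ xs (f ∘ h)
∑-map h xs f = cong sum (sym (Listₚ.map-∘ xs))

∑-bound : ∀ (xs : List X) {f c} → (∀ {x} → x ∈ xs → f x ≤ c) → ∑ xs f ≤ length xs * c
∑-bound xs f≤c = ℕₚ.≤-trans (∑-mono xs f≤c) (ℕₚ.≤-reflexive (∑-const xs _))

∈⇒≤∑ : ∀ {xs : List X} f {x} → x ∈ xs → f x ≤ ∑ xs f
∈⇒≤∑ f (here refl)  = ℕₚ.m≤m+n _ _
∈⇒≤∑ f (there x∈xs) = ℕₚ.≤-trans (∈⇒≤∑ f x∈xs) (ℕₚ.m≤n+m _ _)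

below-average : ∀ (xs : List X) f c → ∑ xs f < length xs * c → ∃[ x ] x ∈ xs × f x < c
below-average (x ∷ xs) f c lt with f x ℕₚ.<? c
... | yes fx<c = x , here refl , fx<c
... | no  fx≮c =
  let y , y∈xs , fy<c = below-average xs f c (ℕₚ.+-cancelˡ-< c (∑ xs f) (length xs * c)
        (ℕₚ.≤-<-trans (ℕₚ.+-monoˡ-≤ (∑ xs f) (ℕₚ.≮⇒≥ fx≮c)) lt))
  in y , there y∈xs , fy<c

maximum : ∀ (x : X) xs (f : X → ℕ) → ∃[ y ] y ∈ x ∷ xs × (∀ {z} → z ∈ x ∷ xs → f z ≤ f y)
maximum x []       f = x , here refl , λ { (here refl) → ℕₚ.≤-refl }
maximum x (y ∷ xs) f with maximum y xs f
... | z , z∈ , max with ℕₚ.≤-total (f x) (f z)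
...   | inj₁ fx≤fz = z , there z∈ , λ { (here refl) → fx≤fz ; (there w∈) → max w∈ }
...   | inj₂ fz≤fx = x , here refl , λ { (here refl) → ℕₚ.≤-refl ; (there w∈) → ℕₚ.≤-trans (max w∈) fz≤fx }

extract : ∀ {x : X} {xs} → x ∈ xs → ∃[ ys ] xs ↭ x ∷ ys
extract x∈xs with ys , zs , refl ← ∈-∃++ x∈xs = ys ++ zs , Perm.shift _ ys zs

∈-tail : ∀ {x y : X} {xs ys} → xs ↭ x ∷ ys → y ∈ xs → y ≢ x → y ∈ ys
∈-tail xs↭ y∈xs y≢x with Perm.∈-resp-↭ xs↭ y∈xs
... | here y≡x  = contradiction y≡x y≢x
... | there y∈  = y∈

unique-∑-≤ : ∀ {xs ys : List X} f → Unique xs → (∀ {x} → x ∈ xs → x ∈ ys) → ∑ xs f ≤ ∑ ys f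
unique-∑-≤ {xs = []}     f uniq       xs⊆ys = z≤n
unique-∑-≤ {xs = x ∷ xs} f (x∉ ∷ uniq) xs⊆ys with zs , ys↭ ← extract (xs⊆ys (here refl)) =
  ℕₚ.≤-trans
    (ℕₚ.+-monoʳ-≤ (f x) (unique-∑-≤ f uniq
      (λ y∈xs → ∈-tail ys↭ (xs⊆ys (there y∈xs)) (λ y≡x → All.lookup x∉ y∈xs (sym y≡x)))))
    (ℕₚ.≤-reflexive (sym (∑-↭ f ys↭)))

-- Indicators and characteristic functions of subsets

𝟙 : Bool → ℕ
𝟙 true  = 1
𝟙 false = 0

𝟙≤1 : ∀ b → 𝟙 b ≤ 1
𝟙≤1 true  = ℕₚ.≤-refl
𝟙≤1 false = z≤n

length-filter : ∀ {P : Pred X 0ℓ} (P? : Decidable P) xs →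
                length (filter P? xs) ≡ ∑ xs (λ x → 𝟙 (does (P? x)))
length-filter P? []       = refl
length-filter P? (x ∷ xs) with does (P? x)
... | true  = cong suc (length-filter P? xs)
... | false = length-filter P? xs

private
  variable
    n : ℕ

χ : Subset n → Fin n → ℕ
χ B v = 𝟙 (lookup B v)

∈⇒χ≡1 : ∀ {B : Subset n} {v} → v ∈ₛ B → χ B v ≡ 1
∈⇒χ≡1 v∈B = cong 𝟙 ([]=⇒lookup v∈B)

∑-χ : ∀ (B : Subset n) → ∑ (allFin n) (χ B) ≡ ∣ B ∣
∑-χ B = trans (cong sum (Listₚ.map-tabulate id (χ B))) (sum-tabulate B)
  where
  sum-tabulate : ∀ {n} (B : Subset n) → sum (tabulate (χ B)) ≡ ∣ B ∣
  sum-tabulate []          = refl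
  sum-tabulate (true ∷ B)  = cong suc (sum-tabulate B)
  sum-tabulate (false ∷ B) = sum-tabulate B

≤⇒𝟙≡1 : ∀ {i j} → i ≤ j → 𝟙 (i ≤ᵇ j) ≡ 1
≤⇒𝟙≡1 {i} {j} i≤j with i ≤ᵇ j | ℕₚ.≤⇒≤ᵇ i≤j
... | true | _ = refl

𝟙-≤ᵇ : ∀ j m {r} → (j ≤ m → 1 ≤ r) → 𝟙 (j ≤ᵇ m) ≤ r
𝟙-≤ᵇ j m 1≤r with j ≤ᵇ m in eq
... | false = z≤n
... | true  = 1≤r (ℕₚ.≤ᵇ⇒≤ j m (subst T (sym eq) _))

𝟙-antitone : ∀ {i j} m → i ≤ j → 𝟙 (j ≤ᵇ m) ≤ 𝟙 (i ≤ᵇ m)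
𝟙-antitone {j = j} m i≤j = 𝟙-≤ᵇ j m (λ j≤m → ℕₚ.≤-reflexive (sym (≤⇒𝟙≡1 (ℕₚ.≤-trans i≤j j≤m))))

-- One more point brings a count up to `suc j` only if the count was there already or was at least
-- `j` before. This discrete derivative drives both the recursion for blocks meeting a set and the
-- update of degrees after a placement.
≤ᵇ-suc-+ : ∀ j m e → e ≤ 1 → 𝟙 (suc j ≤ᵇ m + e) ≤ 𝟙 (suc j ≤ᵇ m) + e * 𝟙 (j ≤ᵇ m)
≤ᵇ-suc-+ j m zero e≤1 = ℕₚ.≤-reflexive
  (trans (cong (λ z → 𝟙 (suc j ≤ᵇ z)) (ℕₚ.+-identityʳ m)) (sym (ℕₚ.+-identityʳ _)))
≤ᵇ-suc-+ j m (suc zero) e≤1 = 𝟙-≤ᵇ (suc j) (m + 1) λ j<m+1 →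
  ℕₚ.≤-trans
    (ℕₚ.≤-reflexive (sym (trans (ℕₚ.*-identityˡ _)
      (≤⇒𝟙≡1 (ℕₚ.≤-pred (subst (suc j ≤_) (ℕₚ.+-comm m 1) j<m+1))))))
    (ℕₚ.m≤n+m _ (𝟙 (suc j ≤ᵇ m)))
≤ᵇ-suc-+ j m (suc (suc e)) (s≤s ())

∣p∪⁅x⁆∣ : ∀ (p : Subset n) x → x ∉ₛ p → ∣ p ∪ ⁅ x ⁆ ∣ ≡ suc ∣ p ∣
∣p∪⁅x⁆∣ (true  ∷ p) Fin.zero    x∉ = contradiction Vec.here x∉
∣p∪⁅x⁆∣ (false ∷ p) Fin.zero    x∉ = cong suc (cong ∣_∣ (Sub.∪-identityʳ p))
∣p∪⁅x⁆∣ (true  ∷ p) (Fin.suc x) x∉ = cong suc (∣p∪⁅x⁆∣ p x (x∉ ∘ Vec.there))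
∣p∪⁅x⁆∣ (false ∷ p) (Fin.suc x) x∉ = ∣p∪⁅x⁆∣ p x (x∉ ∘ Vec.there)

contains : Subset n → Subset n → ℕ
contains F B = 𝟙 (does (F Sub.⊆? B))

⊆⇒contains≡1 : ∀ {F B : Subset n} → F ⊆ B → contains F B ≡ 1
⊆⇒contains≡1 {F = F} {B} F⊆B with F Sub.⊆? B
... | yes _   = refl
... | no F⊈B = contradiction (λ {x} → F⊆B {x}) F⊈B

contains-∪ : ∀ (F B : Subset n) s → χ B s * contains F B ≤ contains (F ∪ ⁅ s ⁆) B
contains-∪ F B s with lookup B s in eq | F Sub.⊆? B
... | false | _     = z≤n
... | true  | no _  = z≤n
... | true  | yes F⊆B = ℕₚ.≤-reflexive (sym (⊆⇒contains≡1 {F = F ∪ ⁅ s ⁆} {B} sub))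
  where
  sub : (F ∪ ⁅ s ⁆) ⊆ B
  sub x∈ with Sub.x∈p∪q⁻ F ⁅ s ⁆ x∈
  ... | inj₁ x∈F = F⊆B x∈F
  ... | inj₂ x∈s rewrite Sub.x∈⁅y⁆⇒x≡y s x∈s = lookup⇒[]= s B eq

-- Number of blocks that meet a set of vertices in many points

module Counting (bs : List (Subset n)) (t lam : ℕ)
  (balance : ∀ T → ∣ T ∣ ≡ t → ∑ bs (contains T) ≤ lam) where

  -- Pascal's recursion: a block meeting s ∷ S in j points either meets S in j points, or
  -- contains s and meets S in j − 1 points.
  blocks-meeting : ∀ S F j → Unique S → (∀ {s} → s ∈ S → s ∉ₛ F) → ∣ F ∣ + j ≡ t →
    ∑ bs (λ B → contains F B * 𝟙 (j ≤ᵇ ∑ S (χ B))) ≤ lam * length S ^ j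
  blocks-meeting S F zero uniq S∩F |F|+j≡t = begin
    ∑ bs (λ B → contains F B * 1)  ≡⟨ ∑-cong bs (λ B → ℕₚ.*-identityʳ (contains F B)) ⟩
    ∑ bs (contains F)              ≤⟨ balance F (trans (sym (ℕₚ.+-identityʳ _)) |F|+j≡t) ⟩
    lam                            ≡⟨ ℕₚ.*-identityʳ lam ⟨
    lam * 1                        ∎
    where open ℕₚ.≤-Reasoning
  blocks-meeting [] F (suc j) uniq S∩F |F|+j≡t = ℕₚ.≤-trans
    (ℕₚ.≤-reflexive (trans (∑-cong bs (λ B → ℕₚ.*-zeroʳ (contains F B)))
      (trans (∑-const bs 0) (ℕₚ.*-zeroʳ (length bs))))) z≤n
  blocks-meeting (s ∷ S) F (suc j) (s∉S ∷ uniq) S∩F |F|+j≡t = begin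
    ∑ bs (λ B → contains F B * 𝟙 (suc j ≤ᵇ χ B s + ∑ S (χ B)))
      ≤⟨ ∑-mono bs (λ {B} _ → split B) ⟩
    ∑ bs (λ B → contains F B * 𝟙 (suc j ≤ᵇ ∑ S (χ B)) + contains F′ B * 𝟙 (j ≤ᵇ ∑ S (χ B)))
      ≡⟨ ∑-+ bs _ _ ⟩
    ∑ bs (λ B → contains F B * 𝟙 (suc j ≤ᵇ ∑ S (χ B))) + ∑ bs (λ B → contains F′ B * 𝟙 (j ≤ᵇ ∑ S (χ B)))
      ≤⟨ ℕₚ.+-mono-≤
           (blocks-meeting S F (suc j) uniq (S∩F ∘ there) |F|+j≡t)
           (blocks-meeting S F′ j uniq S∩F′
             (trans (cong (_+ j) (∣p∪⁅x⁆∣ F s (S∩F (here refl)))) (trans (sym (ℕₚ.+-suc _ j)) |F|+j≡t))) ⟩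
    lam * a ^ suc j + lam * a ^ j
      ≡⟨ lemma lam a (a ^ j) ⟩
    lam * (suc a * a ^ j)
      ≤⟨ ℕₚ.*-monoʳ-≤ lam (ℕₚ.*-monoʳ-≤ (suc a) (ℕₚ.^-monoˡ-≤ j (ℕₚ.n≤1+n a))) ⟩
    lam * suc a ^ suc j ∎
    where
    open ℕₚ.≤-Reasoning
    a : ℕ
    a = length S
    F′ : Subset n
    F′ = F ∪ ⁅ s ⁆
    lemma : ∀ l a p → l * (a * p) + l * p ≡ l * (suc a * p)
    lemma = solve-∀
    S∩F′ : ∀ {x} → x ∈ S → x ∉ₛ F′
    S∩F′ x∈S x∈F′ with Sub.x∈p∪q⁻ F ⁅ s ⁆ x∈F′
    ... | inj₁ x∈F = S∩F (there x∈S) x∈F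
    ... | inj₂ x∈s = All.lookup s∉S x∈S (sym (Sub.x∈⁅y⁆⇒x≡y s x∈s))
    split : ∀ B → contains F B * 𝟙 (suc j ≤ᵇ χ B s + ∑ S (χ B)) ≤
                  contains F B * 𝟙 (suc j ≤ᵇ ∑ S (χ B)) + contains F′ B * 𝟙 (j ≤ᵇ ∑ S (χ B))
    split B = begin
      c * 𝟙 (suc j ≤ᵇ e + m)                     ≡⟨ cong (λ z → c * 𝟙 (suc j ≤ᵇ z)) (ℕₚ.+-comm e m) ⟩
      c * 𝟙 (suc j ≤ᵇ m + e)                     ≤⟨ ℕₚ.*-monoʳ-≤ c (≤ᵇ-suc-+ j m e (𝟙≤1 (lookup B s))) ⟩
      c * (𝟙 (suc j ≤ᵇ m) + e * 𝟙 (j ≤ᵇ m))      ≡⟨ assoc c (𝟙 (suc j ≤ᵇ m)) e (𝟙 (j ≤ᵇ m)) ⟩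
      c * 𝟙 (suc j ≤ᵇ m) + e * c * 𝟙 (j ≤ᵇ m)    ≤⟨ ℕₚ.+-monoʳ-≤ (c * 𝟙 (suc j ≤ᵇ m))
                                                      (ℕₚ.*-monoˡ-≤ (𝟙 (j ≤ᵇ m)) (contains-∪ F B s)) ⟩
      c * 𝟙 (suc j ≤ᵇ m) + contains F′ B * 𝟙 (j ≤ᵇ m) ∎
      where
      c e m : ℕ
      c = contains F B
      e = χ B s
      m = ∑ S (χ B)
      assoc : ∀ c p e q → c * (p + e * q) ≡ c * p + e * c * q
      assoc = solve-∀

-- Partial colourings and the degrees of vertices

∑-indicator : ∀ {M} (e : Fin M) → ∑ (allFin M) (λ d → 𝟙 (does (d Fin.≟ e))) ≤ 1
∑-indicator {M} e = begin
  ∑ (allFin M) (λ d → 𝟙 (does (d Fin.≟ e)))  ≤⟨ ∑-mono (allFin M) (λ {d} _ → ≤χ d) ⟩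
  ∑ (allFin M) (χ ⁅ e ⁆)                     ≡⟨ ∑-χ ⁅ e ⁆ ⟩
  ∣ ⁅ e ⁆ ∣                                  ≡⟨ Sub.∣⁅x⁆∣≡1 e ⟩
  1                                          ∎
  where
  open ℕₚ.≤-Reasoning
  ≤χ : ∀ d → 𝟙 (does (d Fin.≟ e)) ≤ χ ⁅ e ⁆ d
  ≤χ d with d Fin.≟ e
  ... | yes refl = ℕₚ.≤-reflexive (sym (∈⇒χ≡1 (Sub.x∈⁅x⁆ d)))
  ... | no  _    = z≤n

-- Here `k = 3 + k₃` and `t = 1 + t₁`, so the levels k - 3, k - 2 and k - 1 read `k₃`, `suc k₃` and
-- `2 + k₃` without subtraction. `R c e` holds when colour `e` belongs to range `c`.
module Heights {n : ℕ} (bs : List (Subset n)) (k₃ t₁ lam M : ℕ) (t₁≤k₃ : t₁ ≤ k₃)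
  (block-size : ∀ {B} → B ∈ bs → ∣ B ∣ ≤ 3 + k₃)
  (balance : ∀ T → ∣ T ∣ ≡ suc t₁ → ∑ bs (contains T) ≤ lam)
  (R : Fin M → Fin M → Bool) where

  open ℕₚ.≤-Reasoning

  k : ℕ
  k = 3 + k₃

  colours : List (Fin M)
  colours = allFin M

  Placement : Set
  Placement = List (Fin n × Fin M)

  inside : Placement → Subset n → Fin M → ℕ
  inside P B c = ∑ P (λ (v , e) → 𝟙 (R c e) * χ B v)

  range-size : Placement → Fin M → ℕ
  range-size P c = ∑ P (λ (_ , e) → 𝟙 (R c e))

  class-size : Placement → Fin M → ℕ
  class-size P d = ∑ P (λ (_ , e) → 𝟙 (does (d Fin.≟ e)))

  -- For an uncoloured `x`, level k - 1 counts the blocks that a colour of range `c` at `x` would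
  -- complete. Every placement feeds a level from the one below it, so levels k - 2 and k - 3 have
  -- to be followed as well.
  deg : Placement → ℕ → Fin M → Fin n → ℕ
  deg P j c x = ∑ bs (λ B → χ B x * 𝟙 (j ≤ᵇ inside P B c))

  members : Placement → Fin M → List (Fin n)
  members P c = map proj₁ (filter (λ (_ , e) → T? (R c e)) P)

  ∑-members : ∀ P c f → ∑ P (λ (v , e) → 𝟙 (R c e) * f v) ≡ ∑ (members P c) f
  ∑-members []            c f = refl
  ∑-members ((v , e) ∷ P) c f with R c e
  ... | true  = cong₂ _+_ (ℕₚ.*-identityˡ (f v)) (∑-members P c f)
  ... | false = ∑-members P c f

  length-members : ∀ P c → length (members P c) ≡ range-size P c
  length-members P c = trans (Listₚ.length-map proj₁ (filter _ P)) (length-filter (λ (_ , e) → T? (R c e)) P)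

  members-unique : ∀ P c → Unique (map proj₁ P) → Unique (members P c)
  members-unique P c uniq = AllPairsₚ.map⁺ (AllPairsₚ.filter⁺ _ (AllPairsₚ.map⁻ uniq))

  members⊆ : ∀ P c {v} → v ∈ members P c → v ∈ map proj₁ P
  members⊆ P c v∈ with p , p∈ , refl ← ∈-map⁻ proj₁ v∈ = ∈-map⁺ proj₁ (proj₁ (∈-filter⁻ _ p∈))

  ∑-χ-unique : ∀ {B J} → B ∈ bs → Unique J → ∑ J (χ B) ≤ k
  ∑-χ-unique {B} {J} B∈bs uniq = begin
    ∑ J (χ B)           ≤⟨ unique-∑-≤ (χ B) uniq (λ {v} _ → ∈-allFin v) ⟩
    ∑ (allFin n) (χ B)  ≡⟨ ∑-χ B ⟩
    ∣ B ∣               ≤⟨ block-size B∈bs ⟩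
    k                   ∎

  ∑-blocks : ∀ {J} (z : Subset n → ℕ) → Unique J → ∑ J (λ r → ∑ bs (λ B → χ B r * z B)) ≤ k * ∑ bs z
  ∑-blocks {J} z uniq = begin
    ∑ J (λ r → ∑ bs (λ B → χ B r * z B))  ≡⟨ ∑-swap J bs (λ r B → χ B r * z B) ⟩
    ∑ bs (λ B → ∑ J (λ r → χ B r * z B))  ≤⟨ ∑-mono bs (λ {B} B∈bs → ℕₚ.≤-trans
                                               (ℕₚ.≤-reflexive (∑-*ʳ J (χ B) (z B)))
                                               (ℕₚ.*-monoˡ-≤ (z B) (∑-χ-unique B∈bs uniq))) ⟩
    ∑ bs (λ B → k * z B)                  ≡⟨ ∑-*ˡ bs k z ⟩
    k * ∑ bs z                            ∎

  -- Only blocks through `x` can rise, only from level `j`, and only if `d` is a colour of range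
  -- `c`. Each of them has at most `k` points and so adds at most `k` to the sum over `J`.
  deg-place : ∀ P x d j c {J} → Unique J →
    ∑ J (deg ((x , d) ∷ P) (suc j) c) ≤ ∑ J (deg P (suc j) c) + 𝟙 (R c d) * (k * deg P j c x)
  deg-place P x d j c {J} uniq = begin
    ∑ J (deg ((x , d) ∷ P) (suc j) c)
      ≤⟨ ∑-mono J (λ {r} _ → pointwise r) ⟩
    ∑ J (λ r → deg P (suc j) c r + ρ * ∑ bs (λ B → χ B r * z B))
      ≡⟨ ∑-+ J _ _ ⟩
    ∑ J (deg P (suc j) c) + ∑ J (λ r → ρ * ∑ bs (λ B → χ B r * z B))
      ≡⟨ cong (∑ J (deg P (suc j) c) +_) (∑-*ˡ J ρ _) ⟩
    ∑ J (deg P (suc j) c) + ρ * ∑ J (λ r → ∑ bs (λ B → χ B r * z B))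
      ≤⟨ ℕₚ.+-monoʳ-≤ (∑ J (deg P (suc j) c)) (ℕₚ.*-monoʳ-≤ ρ (∑-blocks z uniq)) ⟩
    ∑ J (deg P (suc j) c) + ρ * (k * deg P j c x) ∎
    where
    ρ : ℕ
    ρ = 𝟙 (R c d)
    z : Subset n → ℕ
    z B = χ B x * 𝟙 (j ≤ᵇ inside P B c)
    regroup : ∀ r p ρ s y → r * (p + ρ * s * y) ≡ r * p + ρ * (r * (s * y))
    regroup = solve-∀
    term : ∀ r B → χ B r * 𝟙 (suc j ≤ᵇ ρ * χ B x + inside P B c) ≤
                   χ B r * 𝟙 (suc j ≤ᵇ inside P B c) + ρ * (χ B r * z B)
    term r B = begin
      χ B r * 𝟙 (suc j ≤ᵇ ρ * χ B x + inside P B c)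
        ≡⟨ cong (λ m → χ B r * 𝟙 (suc j ≤ᵇ m)) (ℕₚ.+-comm (ρ * χ B x) (inside P B c)) ⟩
      χ B r * 𝟙 (suc j ≤ᵇ inside P B c + ρ * χ B x)
        ≤⟨ ℕₚ.*-monoʳ-≤ (χ B r) (≤ᵇ-suc-+ j (inside P B c) (ρ * χ B x)
             (ℕₚ.*-mono-≤ (𝟙≤1 (R c d)) (𝟙≤1 (lookup B x)))) ⟩
      χ B r * (𝟙 (suc j ≤ᵇ inside P B c) + ρ * χ B x * 𝟙 (j ≤ᵇ inside P B c))
        ≡⟨ regroup (χ B r) (𝟙 (suc j ≤ᵇ inside P B c)) ρ (χ B x) (𝟙 (j ≤ᵇ inside P B c)) ⟩
      χ B r * 𝟙 (suc j ≤ᵇ inside P B c) + ρ * (χ B r * z B) ∎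
    pointwise : ∀ r → deg ((x , d) ∷ P) (suc j) c r ≤
                      deg P (suc j) c r + ρ * ∑ bs (λ B → χ B r * z B)
    pointwise r = begin
      deg ((x , d) ∷ P) (suc j) c r
        ≤⟨ ∑-mono bs (λ {B} _ → term r B) ⟩
      ∑ bs (λ B → χ B r * 𝟙 (suc j ≤ᵇ inside P B c) + ρ * (χ B r * z B))
        ≡⟨ ∑-+ bs _ _ ⟩
      deg P (suc j) c r + ∑ bs (λ B → ρ * (χ B r * z B))
        ≡⟨ cong (deg P (suc j) c r +_) (∑-*ˡ bs ρ _) ⟩
      deg P (suc j) c r + ρ * ∑ bs (λ B → χ B r * z B) ∎

  open Counting bs (suc t₁) lam balance

  -- Having `i` points in the range implies having `j` of them, and `j` is chosen such that they
  -- complete `F` to a `t`-set, where `blocks-meeting` applies.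
  meets : ∀ P F j i c → j ≤ i → Unique (map proj₁ P) → (∀ {s} → s ∈ map proj₁ P → s ∉ₛ F) → ∣ F ∣ + j ≡ suc t₁ →
    ∑ bs (λ B → contains F B * 𝟙 (i ≤ᵇ inside P B c)) ≤ lam * range-size P c ^ j
  meets P F j i c j≤i uniq P∩F |F|+j≡t = begin
    ∑ bs (λ B → contains F B * 𝟙 (i ≤ᵇ inside P B c))
      ≤⟨ ∑-mono bs (λ {B} _ → ℕₚ.*-monoʳ-≤ (contains F B) (ℕₚ.≤-trans
           (𝟙-antitone (inside P B c) j≤i)
           (ℕₚ.≤-reflexive (cong (λ m → 𝟙 (j ≤ᵇ m)) (∑-members P c (χ B)))))) ⟩
    ∑ bs (λ B → contains F B * 𝟙 (j ≤ᵇ ∑ (members P c) (χ B)))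
      ≤⟨ blocks-meeting (members P c) F j (members-unique P c uniq) (P∩F ∘ members⊆ P c) |F|+j≡t ⟩
    lam * length (members P c) ^ j
      ≡⟨ cong (λ a → lam * a ^ j) (length-members P c) ⟩
    lam * range-size P c ^ j ∎

  -- The case `F = ⁅ x ⁆` and j = t - 1 of `meets`, which relies on k - 3 ≥ t - 1. As `x` is
  -- uncoloured, it is none of the points of the range.
  deg-bound : ∀ P c x → Unique (map proj₁ P) → x ∉ map proj₁ P → deg P k₃ c x ≤ lam * range-size P c ^ t₁
  deg-bound P c x uniq x∉P = ℕₚ.≤-trans
    (∑-mono bs (λ {B} _ → ℕₚ.*-monoˡ-≤ (𝟙 (k₃ ≤ᵇ inside P B c)) (χ≤contains B)))
    (meets P ⁅ x ⁆ t₁ k₃ c t₁≤k₃ uniq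
      (λ {s} s∈P s∈x → x∉P (subst (_∈ map proj₁ P) (Sub.x∈⁅y⁆⇒x≡y x s∈x) s∈P))
      (cong (_+ t₁) (Sub.∣⁅x⁆∣≡1 x)))
    where
    χ≤contains : ∀ B → χ B x ≤ contains ⁅ x ⁆ B
    χ≤contains B with lookup B x in eq
    ... | false = z≤n
    ... | true  = ℕₚ.≤-reflexive (sym (⊆⇒contains≡1 {F = ⁅ x ⁆} {B}
                    λ y∈x → subst (_∈ₛ B) (sym (Sub.x∈⁅y⁆⇒x≡y x y∈x)) (lookup⇒[]= x B eq)))

  -- Each block is counted for at most `k` vertices of `J`; the blocks themselves are bounded by
  -- `meets` with `F = ⊥`, all `t` points being taken from the range.
  ∑-deg-bound : ∀ P c {J} → Unique (map proj₁ P) → Unique J →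
    ∑ J (deg P (suc k₃) c) ≤ k * (lam * range-size P c ^ suc t₁)
  ∑-deg-bound P c {J} uniqP uniqJ = begin
    ∑ J (deg P (suc k₃) c)
      ≤⟨ ∑-blocks _ uniqJ ⟩
    k * ∑ bs (λ B → 𝟙 (suc k₃ ≤ᵇ inside P B c))
      ≤⟨ ℕₚ.*-monoʳ-≤ k (∑-mono bs (λ {B} _ → ℕₚ.≤-reflexive (sym
           (trans (cong (_* 𝟙 (suc k₃ ≤ᵇ inside P B c)) (⊆⇒contains≡1 {F = ⊥} {B} (λ x∈⊥ → contradiction x∈⊥ Sub.∉⊥))) (ℕₚ.*-identityˡ _))))) ⟩
    k * ∑ bs (λ B → contains ⊥ B * 𝟙 (suc k₃ ≤ᵇ inside P B c))
      ≤⟨ ℕₚ.*-monoʳ-≤ k (meets P ⊥ (suc t₁) (suc k₃) c (s≤s t₁≤k₃) uniqP (λ _ → Sub.∉⊥) (cong (_+ suc t₁) (Sub.∣⊥∣≡0 n))) ⟩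
    k * (lam * range-size P c ^ suc t₁) ∎

weaken-∈ : ∀ {X : Set} {x y : X} {xs ys} → xs ↭ x ∷ ys → y ∈ ys → y ∈ xs
weaken-∈ xs↭ y∈ys = Perm.∈-resp-↭ (↭-sym xs↭) (there y∈ys)

unique-resp-↭ : ∀ {X : Set} {xs ys : List X} → xs ↭ ys → Unique xs → Unique ys
unique-resp-↭ xs↭ys = Permₛ.Unique-resp-↭ (setoid _) (↭⇒↭ₛ xs↭ys)

unique-++⁻ : ∀ {X : Set} (xs : List X) {ys} → Unique (xs ++ ys) →
             Unique xs × Unique ys × (∀ {x} → x ∈ xs → x ∉ ys)
unique-++⁻ []       uniq = [] , uniq , λ ()
unique-++⁻ (x ∷ xs) (x∉ ∷ uniq) with unique-++⁻ xs uniq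
... | uniqx , uniqy , disj =
  All.tabulate (λ y∈ → All.lookup x∉ (∈-++⁺ˡ y∈)) ∷ uniqx , uniqy ,
  λ { (here refl) x∈ys → All.lookup x∉ (∈-++⁺ʳ xs x∈ys) refl ; (there z∈) → disj z∈ }

unique-∷ : ∀ {X : Set} {x : X} {xs} → x ∉ xs → Unique xs → Unique (x ∷ xs)
unique-∷ x∉xs uniq = All.tabulate (λ { y∈xs refl → x∉xs y∈xs }) ∷ uniq

-- The colouring process and its invariant

module Process {n : ℕ} (bs : List (Subset n)) (k₃ t₁ lam M : ℕ) (t₁≤k₃ : t₁ ≤ k₃)
  (block-size : ∀ {B} → B ∈ bs → ∣ B ∣ ≤ 3 + k₃)
  (balance : ∀ T → ∣ T ∣ ≡ suc t₁ → ∑ bs (contains T) ≤ lam)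
  (R : Fin M → Fin M → Bool)
  (R-row : ∀ c → ∑ (allFin M) (λ d → 𝟙 (R c d)) ≤ 2)
  (R-col : ∀ d → ∑ (allFin M) (λ c → 𝟙 (R c d)) ≤ 2)
  (q F b : ℕ) .{{_ : NonZero M}} .{{_ : NonZero q}} .{{_ : NonZero F}}
  (n≤2^b : n ≤ 2 ^ b) (4n≤Mq : 4 * n ≤ M * q)
  where

  open Heights bs k₃ t₁ lam M t₁≤k₃ block-size balance R
  open ℕₚ.≤-Reasoning

  -- A range holds at most q + q vertices, so `G` bounds the degree of an uncoloured vertex at level
  -- k - 3. `Δ₁` bounds the growth of the total weight of a set in one placement. `Δ` leaves room
  -- for three such terms, as both cases of `balanced-next` require.
  G Δ₁ Δ : ℕ
  G = lam * (q + q) ^ t₁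
  Δ₁ = F * (k * F) + 2 * (k * G)
  Δ = 3 * Δ₁

  -- The factor `F` lets one bound control two counts of different size: a weight of at most M F / 8
  -- means a danger of at most M / 8 and a level k - 2 count of at most M F / 8, which keeps the
  -- average risk over the colours below `F`.
  danger weight : Placement → Fin n → ℕ
  danger P x = ∑ colours (λ c → deg P (2 + k₃) c x)
  weight P x = F * danger P x + ∑ colours (λ c → deg P (suc k₃) c x)

  -- `conflict P x d` is zero just when colour `d` is not forbidden for an uncoloured `x`.
  -- `risk P x d` counts the pairs of a block through `x` and a range that reach level k - 1 once
  -- `x` receives `d`.
  risk conflict : Placement → Fin n → Fin M → ℕ
  risk P x d = ∑ colours (λ c → 𝟙 (R c d) * deg P (suc k₃) c x)
  conflict P x d = ∑ colours (λ c → 𝟙 (R c d) * deg P (2 + k₃) c x)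

  record State : Set where
    field
      unplaced  : List (Fin n)
      placed    : Placement
      partition : unplaced ++ map proj₁ placed ↭ allFin n

    private
      pieces : Unique unplaced × Unique (map proj₁ placed) × (∀ {x} → x ∈ unplaced → x ∉ map proj₁ placed)
      pieces = unique-++⁻ unplaced (unique-resp-↭ (↭-sym partition) (Uniqueₚ.allFin⁺ n))

    unplaced-unique : Unique unplaced
    unplaced-unique = proj₁ pieces

    placed-unique : Unique (map proj₁ placed)
    placed-unique = proj₁ (proj₂ pieces)

    unplaced∉placed : ∀ {x} → x ∈ unplaced → x ∉ map proj₁ placed
    unplaced∉placed = proj₂ (proj₂ pieces)

    length-placed : length placed ≤ n
    length-placed = begin
      length placed                                       ≡⟨ Listₚ.length-map proj₁ placed ⟨
      length (map proj₁ placed)                           ≤⟨ ℕₚ.m≤n+m _ (length unplaced) ⟩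
      length unplaced + length (map proj₁ placed)         ≡⟨ Listₚ.length-++ unplaced ⟨
      length (unplaced ++ map proj₁ placed)               ≡⟨ Perm.↭-length partition ⟩
      length (allFin n)                                   ≡⟨ Listₚ.length-tabulate id ⟩
      n                                                   ∎

  open State

  -- For |J| = 2ᵃ the bound in balanced is Δ |J| (1 + log₂ (2ᵇ / |J|)), the estimate of the box game.
  record Invariant (s : State) (slack : ℕ) : Set where
    field
      capped   : ∀ d → class-size (placed s) d ≤ q
      clean    : ∀ {B} → B ∈ bs → ∀ c → inside (placed s) B c < k
      bounded  : ∀ c → ∑ (unplaced s) (deg (placed s) (2 + k₃) c) ≤ (k * F) * range-size (placed s) c
      balanced : ∀ a {J} → Unique J → (∀ {x} → x ∈ J → x ∈ unplaced s) →
                 ∑ J (weight (placed s)) ≤ Δ * ((b ∸ a) * length J + 2 ^ a) + slack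

  open Invariant

  record Step (s : State) (x : Fin n) (d : Fin M) : Set where
    field
      next     : State
      removed  : unplaced s ↭ x ∷ unplaced next
      extended : placed next ≡ (x , d) ∷ placed s

  place : ∀ s x d → x ∈ unplaced s → Step s x d
  place s x d x∈U with U′ , U↭ ← extract x∈U = record
    { next = record
      { unplaced  = U′
      ; placed    = (x , d) ∷ placed s
      ; partition = ↭-trans (Perm.shift x U′ (map proj₁ (placed s)))
          (↭-trans (Perm.++⁺ʳ (map proj₁ (placed s)) (↭-sym U↭)) (partition s)) }
    ; removed  = U↭
    ; extended = refl }

  length-removed : ∀ {s x d} (st : Step s x d) → length (unplaced s) ≡ suc (length (unplaced (Step.next st)))
  length-removed st = Perm.↭-length (Step.removed st)

  ∑-class-sizes : ∀ P → ∑ colours (class-size P) ≤ length P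
  ∑-class-sizes P = begin
    ∑ colours (class-size P)
      ≡⟨ ∑-swap colours P (λ d (_ , e) → 𝟙 (does (d Fin.≟ e))) ⟩
    ∑ P (λ (_ , e) → ∑ colours (λ d → 𝟙 (does (d Fin.≟ e))))
      ≤⟨ ∑-bound P {c = 1} (λ {(_ , e)} _ → ∑-indicator e) ⟩
    length P * 1
      ≡⟨ ℕₚ.*-identityʳ (length P) ⟩
    length P ∎

  range-size-≤ : ∀ P c → (∀ d → class-size P d ≤ q) → range-size P c ≤ q + q
  range-size-≤ P c size≤q = begin
    ∑ P (λ (_ , e) → 𝟙 (R c e))
      ≤⟨ ∑-mono P (λ {(_ , e)} _ → pick e) ⟩
    ∑ P (λ (_ , e) → ∑ colours (λ d → 𝟙 (R c d) * 𝟙 (does (d Fin.≟ e))))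
      ≡⟨ ∑-swap P colours (λ (_ , e) d → 𝟙 (R c d) * 𝟙 (does (d Fin.≟ e))) ⟩
    ∑ colours (λ d → ∑ P (λ (_ , e) → 𝟙 (R c d) * 𝟙 (does (d Fin.≟ e))))
      ≤⟨ ∑-mono colours (λ {d} _ → ℕₚ.≤-trans
           (ℕₚ.≤-reflexive (∑-*ˡ P (𝟙 (R c d)) _)) (ℕₚ.*-monoʳ-≤ (𝟙 (R c d)) (size≤q d))) ⟩
    ∑ colours (λ d → 𝟙 (R c d) * q)
      ≡⟨ ∑-*ʳ colours _ q ⟩
    ∑ colours (λ d → 𝟙 (R c d)) * q
      ≤⟨ ℕₚ.*-monoˡ-≤ q (R-row c) ⟩
    2 * q
      ≡⟨ cong (q +_) (ℕₚ.+-identityʳ q) ⟩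
    q + q ∎
    where
    pick : ∀ e → 𝟙 (R c e) ≤ ∑ colours (λ d → 𝟙 (R c d) * 𝟙 (does (d Fin.≟ e)))
    pick e = ℕₚ.≤-trans self (∈⇒≤∑ (λ d → 𝟙 (R c d) * 𝟙 (does (d Fin.≟ e))) (∈-allFin e))
      where
      self : 𝟙 (R c e) ≤ 𝟙 (R c e) * 𝟙 (does (e Fin.≟ e))
      self with e Fin.≟ e
      ... | yes _  = ℕₚ.≤-reflexive (sym (ℕₚ.*-identityʳ _))
      ... | no e≢e = contradiction refl e≢e

  ∑-range-column : ∀ d (f : Fin M → ℕ) u → (∀ c → f c ≤ u) → ∑ colours (λ c → 𝟙 (R c d) * f c) ≤ 2 * u
  ∑-range-column d f u f≤u = begin
    ∑ colours (λ c → 𝟙 (R c d) * f c)  ≤⟨ ∑-mono colours (λ {c} _ → ℕₚ.*-monoʳ-≤ (𝟙 (R c d)) (f≤u c)) ⟩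
    ∑ colours (λ c → 𝟙 (R c d) * u)    ≡⟨ ∑-*ʳ colours _ u ⟩
    ∑ colours (λ c → 𝟙 (R c d)) * u    ≤⟨ ℕₚ.*-monoˡ-≤ u (R-col d) ⟩
    2 * u                              ∎

  ∑-range-row : ∀ (f : Fin M → ℕ) → ∑ colours (λ d → ∑ colours (λ c → 𝟙 (R c d) * f c)) ≤ 2 * ∑ colours f
  ∑-range-row f = begin
    ∑ colours (λ d → ∑ colours (λ c → 𝟙 (R c d) * f c))  ≡⟨ ∑-swap colours colours _ ⟩
    ∑ colours (λ c → ∑ colours (λ d → 𝟙 (R c d) * f c))  ≤⟨ ∑-mono colours (λ {c} _ → ℕₚ.≤-trans
                                                              (ℕₚ.≤-reflexive (∑-*ʳ colours _ (f c)))
                                                              (ℕₚ.*-monoˡ-≤ (f c) (R-row c))) ⟩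
    ∑ colours (λ c → 2 * f c)                            ≡⟨ ∑-*ˡ colours 2 f ⟩
    2 * ∑ colours f                                      ∎

  ∑-deg-place : ∀ P x d j {J} → Unique J →
    ∑ J (λ r → ∑ colours (λ c → deg ((x , d) ∷ P) (suc j) c r)) ≤
    ∑ J (λ r → ∑ colours (λ c → deg P (suc j) c r)) + k * ∑ colours (λ c → 𝟙 (R c d) * deg P j c x)
  ∑-deg-place P x d j {J} uniq = begin
    ∑ J (λ r → ∑ colours (λ c → deg P′ (suc j) c r))
      ≡⟨ ∑-swap J colours (λ r c → deg P′ (suc j) c r) ⟩
    ∑ colours (λ c → ∑ J (deg P′ (suc j) c))
      ≤⟨ ∑-mono colours (λ {c} _ → ℕₚ.≤-trans (deg-place P x d j c uniq)
           (ℕₚ.≤-reflexive (cong (∑ J (deg P (suc j) c) +_) (lemma (𝟙 (R c d)) k (deg P j c x))))) ⟩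
    ∑ colours (λ c → ∑ J (deg P (suc j) c) + k * (𝟙 (R c d) * deg P j c x))
      ≡⟨ ∑-+ colours _ _ ⟩
    ∑ colours (λ c → ∑ J (deg P (suc j) c)) + ∑ colours (λ c → k * (𝟙 (R c d) * deg P j c x))
      ≡⟨ cong₂ _+_ (sym (∑-swap J colours (λ r c → deg P (suc j) c r))) (∑-*ˡ colours k _) ⟩
    ∑ J (λ r → ∑ colours (λ c → deg P (suc j) c r)) + k * ∑ colours (λ c → 𝟙 (R c d) * deg P j c x) ∎
    where
    P′ : Placement
    P′ = (x , d) ∷ P
    lemma : ∀ r k g → r * (k * g) ≡ k * (r * g)
    lemma = solve-∀

  -- Each count grows by at most `k` times the level below it at `x`, taken over the ranges
  -- containing `d`: the danger by k times the risk, the level k - 2 count by k times 2 G, as `d`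
  -- lies in at most two ranges.
  weight-place : ∀ P x d {J} → Unique J → Unique (map proj₁ P) → x ∉ map proj₁ P →
    (∀ d → class-size P d ≤ q) → risk P x d ≤ F →
    ∑ J (weight ((x , d) ∷ P)) ≤ ∑ J (weight P) + Δ₁
  weight-place P x d {J} uniq uniqP x∉P size≤q risk≤F = begin
    ∑ J (weight P′)
      ≡⟨ expand P′ ⟩
    F * ∑ J (danger P′) + ∑ J (λ r → ∑ colours (λ c → deg P′ (suc k₃) c r))
      ≤⟨ ℕₚ.+-mono-≤ (ℕₚ.*-monoʳ-≤ F (∑-deg-place P x d (suc k₃) uniq)) (∑-deg-place P x d k₃ uniq) ⟩
    F * (∑ J (danger P) + k * risk P x d) + (L + k * ∑ colours (λ c → 𝟙 (R c d) * deg P k₃ c x))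
      ≤⟨ ℕₚ.+-mono-≤
           (ℕₚ.*-monoʳ-≤ F (ℕₚ.+-monoʳ-≤ (∑ J (danger P)) (ℕₚ.*-monoʳ-≤ k risk≤F)))
           (ℕₚ.+-monoʳ-≤ L (ℕₚ.*-monoʳ-≤ k (∑-range-column d (λ c → deg P k₃ c x) G deg≤G))) ⟩
    F * (∑ J (danger P) + k * F) + (L + k * (2 * G))
      ≡⟨ lemma F (∑ J (danger P)) k L G ⟩
    F * ∑ J (danger P) + L + Δ₁
      ≡⟨ cong (_+ Δ₁) (sym (expand P)) ⟩
    ∑ J (weight P) + Δ₁ ∎
    where
    P′ : Placement
    P′ = (x , d) ∷ P
    L : ℕ
    L = ∑ J (λ r → ∑ colours (λ c → deg P (suc k₃) c r))
    expand : ∀ P → ∑ J (weight P) ≡ F * ∑ J (danger P) + ∑ J (λ r → ∑ colours (λ c → deg P (suc k₃) c r))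
    expand P = trans (∑-+ J _ _) (cong (_+ ∑ J (λ r → ∑ colours (λ c → deg P (suc k₃) c r))) (∑-*ˡ J F (danger P)))
    lemma : ∀ F A k L G → F * (A + k * F) + (L + k * (2 * G)) ≡ F * A + L + (F * (k * F) + 2 * (k * G))
    lemma = solve-∀
    deg≤G : ∀ c → deg P k₃ c x ≤ G
    deg≤G c = ℕₚ.≤-trans (deg-bound P c x uniqP x∉P)
      (ℕₚ.*-monoʳ-≤ lam (ℕₚ.^-monoˡ-≤ t₁ (range-size-≤ P c size≤q)))

  -- One placement preserves the invariant

  module Placed {s x d} (st : Step s x d) {slack} (inv : Invariant s slack) (x∈U : x ∈ unplaced s)
    (no-conflict : conflict (placed s) x d ≡ 0) (low-risk : risk (placed s) x d ≤ F)
    (not-full : class-size (placed s) d < q) where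

    open Step st

    P : Placement
    P = placed s

    capped-next : ∀ e → class-size (placed next) e ≤ q
    capped-next e rewrite extended with e Fin.≟ d
    ... | yes refl = not-full
    ... | no  _    = capped inv e

    -- A block can fill a range now only if `x` is its last missing point. Then it had k - 1 points
    -- in a range of colour `d` and would be counted in the conflict, which is zero.
    clean-next : ∀ {B} → B ∈ bs → ∀ c → inside (placed next) B c < k
    clean-next {B} B∈bs c rewrite extended with R c d in Rcd | lookup B x in Bx
    ... | false | _     = clean inv B∈bs c
    ... | true  | false = clean inv B∈bs c
    ... | true  | true  with 2 + k₃ ℕₚ.≤? inside P B c
    ...   | no  2+k₃≰ = s≤s (ℕₚ.≰⇒> 2+k₃≰)
    ...   | yes 2+k₃≤ = contradiction (begin
              1                                    ≡⟨ sym (≤⇒𝟙≡1 2+k₃≤) ⟩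
              𝟙 (2 + k₃ ≤ᵇ inside P B c)           ≡⟨ sym (ℕₚ.*-identityˡ _) ⟩
              1 * 𝟙 (2 + k₃ ≤ᵇ inside P B c)       ≡⟨ cong (λ e → 𝟙 e * 𝟙 (2 + k₃ ≤ᵇ inside P B c)) (sym Bx) ⟩
              χ B x * 𝟙 (2 + k₃ ≤ᵇ inside P B c)   ≤⟨ ∈⇒≤∑ (λ B → χ B x * 𝟙 (2 + k₃ ≤ᵇ inside P B c)) B∈bs ⟩
              deg P (2 + k₃) c x                   ≡⟨ sym (ℕₚ.*-identityˡ _) ⟩
              1 * deg P (2 + k₃) c x               ≡⟨ cong (λ e → 𝟙 e * deg P (2 + k₃) c x) (sym Rcd) ⟩
              𝟙 (R c d) * deg P (2 + k₃) c x       ≤⟨ ∈⇒≤∑ (λ c → 𝟙 (R c d) * deg P (2 + k₃) c x) (∈-allFin c) ⟩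
              conflict P x d                       ≡⟨ no-conflict ⟩
              0                                    ∎) λ ()

    U′-unique : Unique (unplaced next)
    U′-unique = unplaced-unique next

    U′⊆U : ∀ {y} → y ∈ unplaced next → y ∈ unplaced s
    U′⊆U = weaken-∈ removed

    -- The level k - 1 degrees of a range grow only when a vertex enters that range, and then by at
    -- most `k` times the risk. This bound for single ranges is what allows a colour to be
    -- prescribed in `choose-vertex`.
    bounded-next : ∀ c → ∑ (unplaced next) (deg (placed next) (2 + k₃) c) ≤ (k * F) * range-size (placed next) c
    bounded-next c rewrite extended = begin
      ∑ (unplaced next) (deg ((x , d) ∷ P) (2 + k₃) c)
        ≤⟨ deg-place P x d (suc k₃) c U′-unique ⟩
      ∑ (unplaced next) (deg P (2 + k₃) c) + 𝟙 (R c d) * (k * deg P (suc k₃) c x)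
        ≤⟨ ℕₚ.+-mono-≤ (ℕₚ.≤-trans (unique-∑-≤ (deg P (2 + k₃) c) U′-unique U′⊆U) (bounded inv c)) gain ⟩
      (k * F) * range-size P c + (k * F) * 𝟙 (R c d)
        ≡⟨ trans (sym (ℕₚ.*-distribˡ-+ (k * F) (range-size P c) (𝟙 (R c d)))) (cong ((k * F) *_) (ℕₚ.+-comm (range-size P c) (𝟙 (R c d)))) ⟩
      (k * F) * (𝟙 (R c d) + range-size P c) ∎
      where
      gain : 𝟙 (R c d) * (k * deg P (suc k₃) c x) ≤ (k * F) * 𝟙 (R c d)
      gain with R c d in Rcd
      ... | false = z≤n
      ... | true  = begin
        1 * (k * deg P (suc k₃) c x)  ≡⟨ ℕₚ.*-identityˡ _ ⟩
        k * deg P (suc k₃) c x        ≡⟨ cong (k *_) (trans (sym (ℕₚ.*-identityˡ _)) (cong (λ e → 𝟙 e * deg P (suc k₃) c x) (sym Rcd))) ⟩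
        k * (𝟙 (R c d) * deg P (suc k₃) c x)
          ≤⟨ ℕₚ.*-monoʳ-≤ k (ℕₚ.≤-trans (∈⇒≤∑ (λ c → 𝟙 (R c d) * deg P (suc k₃) c x) (∈-allFin c)) low-risk) ⟩
        k * F                         ≡⟨ sym (ℕₚ.*-identityʳ (k * F)) ⟩
        (k * F) * 1                   ∎

    weight-next : ∀ {J} → Unique J → ∑ J (weight (placed next)) ≤ ∑ J (weight P) + Δ₁
    weight-next uniq rewrite extended =
      weight-place P x d uniq (placed-unique s) (unplaced∉placed s x∈U) (capped inv) low-risk

    -- Without assuming that `x` is heaviest, the growth cannot be absorbed at once; it is recorded
    -- as slack, which the next placement of a heaviest vertex removes.
    free-next : Invariant next (slack + Δ₁)
    free-next = record
      { capped   = capped-next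
      ; clean    = clean-next
      ; bounded  = bounded-next
      ; balanced = λ a {J} uniq J⊆U′ → begin
          ∑ J (weight (placed next))                              ≤⟨ weight-next uniq ⟩
          ∑ J (weight P) + Δ₁                                     ≤⟨ ℕₚ.+-monoˡ-≤ Δ₁ (balanced inv a uniq (U′⊆U ∘ J⊆U′)) ⟩
          Δ * ((b ∸ a) * length J + 2 ^ a) + slack + Δ₁           ≡⟨ ℕₚ.+-assoc (Δ * ((b ∸ a) * length J + 2 ^ a)) slack Δ₁ ⟩
          Δ * ((b ∸ a) * length J + 2 ^ a) + (slack + Δ₁)         ∎
      }

    module Heaviest (slack≡Δ₁ : slack ≡ Δ₁) (heaviest : ∀ {y} → y ∈ unplaced s → weight P y ≤ weight P x) where

      -- A set with at most 2ᵃ elements is compared with J ∪ {x} at the same `a`, a larger set with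
      -- itself at `suc a`. In both cases the growth and the old slack disappear.
      balanced-next : ∀ a {J} → Unique J → (∀ {y} → y ∈ J → y ∈ unplaced next) →
                      ∑ J (weight (placed next)) ≤ Δ * ((b ∸ a) * length J + 2 ^ a) + 0
      balanced-next a {J} uniq J⊆U′ = ℕₚ.≤-trans (weight-next uniq) (ℕₚ.≤-trans bound (ℕₚ.m≤m+n _ 0))
        where
        j p W : ℕ
        j = length J
        p = 2 ^ a
        W = ∑ J (weight P)

        x∉J : x ∉ J
        x∉J x∈J with x≢ ∷ _ ← unique-resp-↭ removed (unplaced-unique s) = All.lookup x≢ (J⊆U′ x∈J) refl

        J⊆U : ∀ {y} → y ∈ J → y ∈ unplaced s
        J⊆U = U′⊆U ∘ J⊆U′

        xJ⊆U : ∀ {y} → y ∈ x ∷ J → y ∈ unplaced s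
        xJ⊆U (here refl) = x∈U
        xJ⊆U (there y∈J) = J⊆U y∈J

        1≤p : 1 ≤ p
        1≤p = ℕₚ.m^n>0 2 a

        -- A heaviest vertex outweighs the average of J, so removing it beats the growth Δ₁.
        small : j ≤ p → W + Δ₁ ≤ Δ * ((b ∸ a) * j + p)
        small j≤p = ℕₚ.*-cancelˡ-≤ (suc j) (begin
          suc j * (W + Δ₁)
            ≡⟨ expand j W Δ₁ ⟩
          W + j * W + suc j * Δ₁
            ≤⟨ ℕₚ.+-monoˡ-≤ (suc j * Δ₁) (ℕₚ.+-monoˡ-≤ (j * W) (∑-bound J (λ y∈J → heaviest (J⊆U y∈J)))) ⟩
          j * weight P x + j * W + suc j * Δ₁
            ≡⟨ cong (_+ suc j * Δ₁) (sym (ℕₚ.*-distribˡ-+ j (weight P x) W)) ⟩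
          j * ∑ (x ∷ J) (weight P) + suc j * Δ₁
            ≤⟨ ℕₚ.+-monoˡ-≤ (suc j * Δ₁) (ℕₚ.*-monoʳ-≤ j (subst (λ e → _ ≤ Δ * ((b ∸ a) * suc j + p) + e) slack≡Δ₁
                 (balanced inv a (unique-∷ x∉J uniq) xJ⊆U))) ⟩
          j * (Δ * ((b ∸ a) * suc j + p) + Δ₁) + suc j * Δ₁
            ≡⟨ collect j Δ₁ (b ∸ a) p ⟩
          j * (Δ * (b ∸ a) * suc j + Δ * p) + (1 + (j + j)) * Δ₁
            ≤⟨ ℕₚ.+-monoʳ-≤ (j * (Δ * (b ∸ a) * suc j + Δ * p))
                 (ℕₚ.*-monoˡ-≤ Δ₁ (ℕₚ.+-mono-≤ 1≤p (ℕₚ.+-mono-≤ j≤p j≤p))) ⟩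
          j * (Δ * (b ∸ a) * suc j + Δ * p) + (p + (p + p)) * Δ₁
            ≡⟨ finish j Δ₁ (b ∸ a) p ⟩
          suc j * (Δ * ((b ∸ a) * j + p)) ∎)
          where
          expand : ∀ j W D → suc j * (W + D) ≡ W + j * W + suc j * D
          expand = solve-∀
          collect : ∀ j D c p → j * (3 * D * (c * suc j + p) + D) + suc j * D ≡
                                j * (3 * D * c * suc j + 3 * D * p) + (1 + (j + j)) * D
          collect = solve-∀
          finish : ∀ j D c p → j * (3 * D * c * suc j + 3 * D * p) + (p + (p + p)) * D ≡
                               suc j * (3 * D * (c * j + p))
          finish = solve-∀

        -- Passing to `suc a` replaces `p` by 2 p but saves one summand `j` ≥ p + 1. The gain of at
        -- least one `Δ`, that is three `Δ₁`, covers the slack and the growth.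
        large : p < j → W + Δ₁ ≤ Δ * ((b ∸ a) * j + p)
        large p<j = begin
          W + Δ₁
            ≤⟨ ℕₚ.+-monoˡ-≤ Δ₁ (subst (λ e → W ≤ Δ * ((b ∸ suc a) * j + 2 ^ suc a) + e) slack≡Δ₁ (balanced inv (suc a) uniq J⊆U)) ⟩
          Δ * ((b ∸ suc a) * j + 2 * p) + Δ₁ + Δ₁
            ≤⟨ ℕₚ.m≤m+n _ Δ₁ ⟩
          Δ * ((b ∸ suc a) * j + 2 * p) + Δ₁ + Δ₁ + Δ₁
            ≡⟨ collect Δ₁ ((b ∸ suc a) * j) p ⟩
          Δ * ((b ∸ suc a) * j + (suc p + p))
            ≤⟨ ℕₚ.*-monoʳ-≤ Δ (ℕₚ.+-monoʳ-≤ ((b ∸ suc a) * j) (ℕₚ.+-monoˡ-≤ p p<j)) ⟩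
          Δ * ((b ∸ suc a) * j + (j + p))
            ≡⟨ regroup Δ (b ∸ suc a) j p ⟩
          Δ * (suc (b ∸ suc a) * j + p)
            ≡⟨ cong (λ c → Δ * (c * j + p)) (sym (ℕₚ.+-∸-assoc 1 a<b)) ⟩
          Δ * ((b ∸ a) * j + p) ∎
          where
          collect : ∀ D c p → 3 * D * (c + 2 * p) + D + D + D ≡ 3 * D * (c + (suc p + p))
          collect = solve-∀
          regroup : ∀ D c j p → D * (c * j + (j + p)) ≡ D * (suc c * j + p)
          regroup = solve-∀
          j≤n : j ≤ n
          j≤n = begin
            j                         ≡⟨ trans (sym (ℕₚ.*-identityʳ j)) (sym (∑-const J 1)) ⟩
            ∑ J (λ _ → 1)             ≤⟨ unique-∑-≤ (λ _ → 1) uniq (λ {v} _ → ∈-allFin v) ⟩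
            ∑ (allFin n) (λ _ → 1)    ≡⟨ trans (∑-const (allFin n) 1) (ℕₚ.*-identityʳ _) ⟩
            length (allFin n)         ≡⟨ Listₚ.length-tabulate id ⟩
            n                         ∎
          -- Ensures that b ∸ a is one more than b ∸ suc a, without truncation.
          a<b : a < b
          a<b = ℕₚ.≰⇒> (λ b≤a → ℕₚ.<-irrefl refl (begin-strict
            p      <⟨ p<j ⟩
            j      ≤⟨ j≤n ⟩
            n      ≤⟨ n≤2^b ⟩
            2 ^ b  ≤⟨ ℕₚ.^-monoʳ-≤ 2 b≤a ⟩
            p      ∎))

        bound : W + Δ₁ ≤ Δ * ((b ∸ a) * j + p)
        bound with ℕₚ.≤-<-connex j p
        ... | inj₁ j≤p = small j≤p
        ... | inj₂ p<j = large p<j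

      heaviest-next : Invariant next 0
      heaviest-next = record
        { capped = capped-next ; clean = clean-next ; bounded = bounded-next ; balanced = balanced-next }

  weaken : ∀ {s} → Invariant s 0 → Invariant s Δ₁
  weaken inv = record
    { capped = capped inv ; clean = clean inv ; bounded = bounded inv
    ; balanced = λ a {J} uniq J⊆U → ℕₚ.≤-trans (balanced inv a uniq J⊆U)
        (ℕₚ.+-monoʳ-≤ (Δ * ((b ∸ a) * length J + 2 ^ a)) z≤n) }

  <⇒≡0 : ∀ m u → m * u < u → m ≡ 0
  <⇒≡0 zero    u lt = refl
  <⇒≡0 (suc m) u lt = contradiction lt (ℕₚ.≤⇒≯ (ℕₚ.m≤m+n u (m * u)))

  -- Choosing a colour or a vertex by averaging

  module Steps (few : 8 * (Δ * (b + 2)) ≤ M * F)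
    (room : 4 * (F * (k * F * (q + q))) + 4 * (k * (lam * (q + q) ^ suc t₁)) < n * F) where

    -- The box game bound for the singleton J = {x} with a = 0, which is Δ (b + 1); one further `Δ`
    -- pays for the slack.
    weight-bound : ∀ {s x} → Invariant s Δ₁ → x ∈ unplaced s → 8 * weight (placed s) x ≤ M * F
    weight-bound {s} {x} inv x∈U = begin
      8 * weight (placed s) x
        ≡⟨ cong (8 *_) (sym (ℕₚ.+-identityʳ (weight (placed s) x))) ⟩
      8 * ∑ (x ∷ []) (weight (placed s))
        ≤⟨ ℕₚ.*-monoʳ-≤ 8 (balanced inv 0 ([] ∷ []) (λ { (here refl) → x∈U })) ⟩
      8 * (Δ * (b * 1 + 1) + Δ₁)
        ≤⟨ ℕₚ.*-monoʳ-≤ 8 (ℕₚ.+-monoʳ-≤ (Δ * (b * 1 + 1)) (ℕₚ.m≤m+n Δ₁ (2 * Δ₁))) ⟩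
      8 * (Δ * (b * 1 + 1) + Δ)
        ≡⟨ lemma Δ b ⟩
      8 * (Δ * (b + 2))
        ≤⟨ few ⟩
      M * F ∎
      where
      lemma : ∀ D b → 8 * (D * (b * 1 + 1) + D) ≡ 8 * (D * (b + 2))
      lemma = solve-∀

    record Choice (P : Placement) (x : Fin n) (d : Fin M) : Set where
      constructor choice
      field
        no-conflict : conflict P x d ≡ 0
        low-risk    : risk P x d ≤ F
        not-full    : class-size P d < q

    -- A single cost encodes three demands: a total below q F forces zero conflict, a class below
    -- its capacity and a risk of at most `F`. Each of the three summands has an average of at most
    -- q F / 4 over the `M` colours, so some colour meets all demands.
    choose-colour : ∀ {s x} → Invariant s Δ₁ → x ∈ unplaced s → ∃[ d ] Choice (placed s) x d
    choose-colour {s} {x} inv x∈U =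
      let d , _ , cost<qF = below-average colours cost (q * F) total in
      d , choice
        (<⇒≡0 (conflict P x d) (q * F) (ℕₚ.≤-<-trans (ℕₚ.≤-trans (ℕₚ.m≤m+n _ _) (ℕₚ.m≤m+n _ _)) cost<qF))
        (ℕₚ.<⇒≤ (ℕₚ.*-cancelˡ-< q _ _ (ℕₚ.≤-<-trans (ℕₚ.m≤n+m _ _) cost<qF)))
        (ℕₚ.*-cancelʳ-< F _ _ (ℕₚ.≤-<-trans (ℕₚ.≤-trans
          (ℕₚ.m≤n+m (class-size P d * F) (conflict P x d * (q * F))) (ℕₚ.m≤m+n _ _)) cost<qF))
      where
      P : Placement
      P = placed s
      cost : Fin M → ℕ
      cost d = conflict P x d * (q * F) + class-size P d * F + q * risk P x d
      h₁ h₂ : ℕ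
      h₁ = danger P x
      h₂ = ∑ colours (λ c → deg P (suc k₃) c x)
      8h₁≤M : 8 * h₁ ≤ M
      8h₁≤M = ℕₚ.*-cancelʳ-≤ _ _ F (begin
        8 * h₁ * F          ≡⟨ trans (ℕₚ.*-assoc 8 h₁ F) (cong (8 *_) (ℕₚ.*-comm h₁ F)) ⟩
        8 * (F * h₁)        ≤⟨ ℕₚ.*-monoʳ-≤ 8 (ℕₚ.m≤m+n (F * h₁) h₂) ⟩
        8 * weight P x      ≤⟨ weight-bound inv x∈U ⟩
        M * F               ∎)
      8h₂≤MF : 8 * h₂ ≤ M * F
      8h₂≤MF = ℕₚ.≤-trans (ℕₚ.*-monoʳ-≤ 8 (ℕₚ.m≤n+m h₂ (F * h₁))) (weight-bound inv x∈U)
      ∑-cost : ∑ colours cost ≤ 2 * h₁ * (q * F) + n * F + q * (2 * h₂)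
      ∑-cost = begin
        ∑ colours cost
          ≡⟨ trans (∑-+ colours _ _) (cong₂ _+_ (∑-+ colours _ _) (∑-*ˡ colours q (risk P x))) ⟩
        ∑ colours (λ d → conflict P x d * (q * F)) + ∑ colours (λ d → class-size P d * F) + q * ∑ colours (risk P x)
          ≡⟨ cong (_+ q * ∑ colours (risk P x)) (cong₂ _+_ (∑-*ʳ colours (conflict P x) (q * F)) (∑-*ʳ colours (class-size P) F)) ⟩
        ∑ colours (conflict P x) * (q * F) + ∑ colours (class-size P) * F + q * ∑ colours (risk P x)
          ≤⟨ ℕₚ.+-mono-≤ (ℕₚ.+-mono-≤
               (ℕₚ.*-monoˡ-≤ (q * F) (∑-range-row (λ c → deg P (2 + k₃) c x)))
               (ℕₚ.*-monoˡ-≤ F (ℕₚ.≤-trans (∑-class-sizes P) (length-placed s))))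
               (ℕₚ.*-monoʳ-≤ q (∑-range-row (λ c → deg P (suc k₃) c x))) ⟩
        2 * h₁ * (q * F) + n * F + q * (2 * h₂) ∎
      total : ∑ colours cost < length colours * (q * F)
      total = ℕₚ.≤-<-trans ∑-cost (ℕₚ.*-cancelˡ-< 4 _ _ (begin-strict
        4 * (2 * h₁ * (q * F) + n * F + q * (2 * h₂))
          ≡⟨ lemma₁ h₁ q F n h₂ ⟩
        8 * h₁ * (q * F) + 4 * n * F + q * (8 * h₂)
          ≤⟨ ℕₚ.+-mono-≤ (ℕₚ.+-mono-≤ (ℕₚ.*-monoˡ-≤ (q * F) 8h₁≤M) (ℕₚ.*-monoˡ-≤ F 4n≤Mq)) (ℕₚ.*-monoʳ-≤ q 8h₂≤MF) ⟩
        M * (q * F) + M * q * F + q * (M * F)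
          ≡⟨ lemma₂ M q F ⟩
        3 * (M * (q * F))
          <⟨ ℕₚ.*-monoˡ-< (M * (q * F)) (ℕₚ.n<1+n 3) ⟩
        4 * (M * (q * F))
          ≡⟨ cong (λ l → 4 * (l * (q * F))) (sym (Listₚ.length-tabulate {n = M} id)) ⟩
        4 * (length colours * (q * F)) ∎))
        where
        instance
          qF≢0 : NonZero (q * F)
          qF≢0 = ℕₚ.m*n≢0 q F
          MqF≢0 : NonZero (M * (q * F))
          MqF≢0 = ℕₚ.m*n≢0 M (q * F)
        lemma₁ : ∀ h q F n g → 4 * (2 * h * (q * F) + n * F + q * (2 * g)) ≡ 8 * h * (q * F) + 4 * n * F + q * (8 * g)
        lemma₁ = solve-∀
        lemma₂ : ∀ M q F → M * (q * F) + M * q * F + q * (M * F) ≡ 3 * (M * (q * F))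
        lemma₂ = solve-∀

    -- The dual averaging, over the uncoloured vertices for a fixed colour. After exchanging the
    -- sums, `bounded` controls the conflicts and `∑-deg-bound` the risks, and at least n / 2
    -- vertices share the total.
    choose-vertex : ∀ {s} d → Invariant s 0 → n ≤ 2 * length (unplaced s) → class-size (placed s) d < q →
                    ∃[ x ] x ∈ unplaced s × Choice (placed s) x d
    choose-vertex {s} d inv n≤2U not-full =
      let x , x∈U , cost<F = below-average (unplaced s) cost F total in
      x , x∈U , choice
        (<⇒≡0 (conflict P x d) F (ℕₚ.≤-<-trans (ℕₚ.m≤m+n _ _) cost<F))
        (ℕₚ.<⇒≤ (ℕₚ.≤-<-trans (ℕₚ.m≤n+m _ _) cost<F))
        not-full
      where
      P : Placement
      P = placed s
      cost : Fin n → ℕ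
      cost x = conflict P x d * F + risk P x d
      small : ∀ c → range-size P c ≤ q + q
      small c = range-size-≤ P c (capped inv)
      swapped : ∀ j → ∑ (unplaced s) (λ x → ∑ colours (λ c → 𝟙 (R c d) * deg P j c x)) ≡
                      ∑ colours (λ c → 𝟙 (R c d) * ∑ (unplaced s) (deg P j c))
      swapped j = trans (∑-swap (unplaced s) colours _) (∑-cong colours (λ c → ∑-*ˡ (unplaced s) (𝟙 (R c d)) (deg P j c)))
      ∑-cost : ∑ (unplaced s) cost ≤ 2 * (k * F * (q + q)) * F + 2 * (k * (lam * (q + q) ^ suc t₁))
      ∑-cost = begin
        ∑ (unplaced s) cost
          ≡⟨ trans (∑-+ (unplaced s) _ _) (cong (_+ ∑ (unplaced s) (λ x → risk P x d)) (∑-*ʳ (unplaced s) _ F)) ⟩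
        ∑ (unplaced s) (λ x → conflict P x d) * F + ∑ (unplaced s) (λ x → risk P x d)
          ≡⟨ cong₂ (λ u v → u * F + v) (swapped (2 + k₃)) (swapped (suc k₃)) ⟩
        ∑ colours (λ c → 𝟙 (R c d) * ∑ (unplaced s) (deg P (2 + k₃) c)) * F +
        ∑ colours (λ c → 𝟙 (R c d) * ∑ (unplaced s) (deg P (suc k₃) c))
          ≤⟨ ℕₚ.+-mono-≤
               (ℕₚ.*-monoˡ-≤ F (∑-range-column d _ (k * F * (q + q)) (λ c →
                 ℕₚ.≤-trans (bounded inv c) (ℕₚ.*-monoʳ-≤ (k * F) (small c)))))
               (∑-range-column d _ (k * (lam * (q + q) ^ suc t₁)) (λ c →
                 ℕₚ.≤-trans (∑-deg-bound P c (placed-unique s) (unplaced-unique s))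
                   (ℕₚ.*-monoʳ-≤ k (ℕₚ.*-monoʳ-≤ lam (ℕₚ.^-monoˡ-≤ (suc t₁) (small c)))))) ⟩
        2 * (k * F * (q + q)) * F + 2 * (k * (lam * (q + q) ^ suc t₁)) ∎
      total : ∑ (unplaced s) cost < length (unplaced s) * F
      total = ℕₚ.≤-<-trans ∑-cost (ℕₚ.*-cancelˡ-< 2 _ _ (begin-strict
        2 * (2 * (k * F * (q + q)) * F + 2 * (k * (lam * (q + q) ^ suc t₁)))
          ≡⟨ lemma (k * F * (q + q)) F (k * (lam * (q + q) ^ suc t₁)) ⟩
        4 * (F * (k * F * (q + q))) + 4 * (k * (lam * (q + q) ^ suc t₁))
          <⟨ room ⟩
        n * F
          ≤⟨ ℕₚ.*-monoˡ-≤ F n≤2U ⟩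
        2 * length (unplaced s) * F
          ≡⟨ ℕₚ.*-assoc 2 (length (unplaced s)) F ⟩
        2 * (length (unplaced s) * F) ∎))
        where
        lemma : ∀ A F B → 2 * (2 * A * F + 2 * B) ≡ 4 * (F * A) + 4 * B
        lemma = solve-∀

    -- Rounds of placements and the complete colouring

    Grows : State → State → Set
    Grows s s′ = ∀ e → class-size (placed s) e ≤ class-size (placed s′) e

    step-grows : ∀ {s x d} (st : Step s x d) → Grows s (Step.next st)
    step-grows st e rewrite Step.extended st = ℕₚ.m≤n+m _ _

    step-fills : ∀ {s x d} (st : Step s x d) → class-size (placed s) d < class-size (placed (Step.next st)) d
    step-fills {d = d} st rewrite Step.extended st with d Fin.≟ d
    ... | yes _  = ℕₚ.≤-refl
    ... | no d≢d = contradiction refl d≢d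

    -- Colours a heaviest vertex and thereby uses up the slack. If no vertex is left, only J = ∅ has
    -- to be balanced and the slack can simply be dropped; the truncated `∸ 1` covers this case.
    settle : ∀ s → Invariant s Δ₁ → ∃[ s′ ] Invariant s′ 0 × Grows s s′ ×
             length (unplaced s′) ≡ length (unplaced s) ∸ 1
    settle s inv with unplaced s in eq
    ... | [] = s , record
        { capped = capped inv ; clean = clean inv ; bounded = bounded inv ; balanced = none }
      , (λ e → ℕₚ.≤-refl) , cong length eq
      where
      none : ∀ a {J} → Unique J → (∀ {x} → x ∈ J → x ∈ unplaced s) →
             ∑ J (weight (placed s)) ≤ Δ * ((b ∸ a) * length J + 2 ^ a) + 0
      none a {[]}    uniq J⊆U = z≤n
      none a {x ∷ J} uniq J⊆U with () ← subst (x ∈_) eq (J⊆U (here refl))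
    ... | u ∷ us =
      let x , x∈ , heaviest = maximum u us (weight (placed s))
          x∈U = subst (x ∈_) (sym eq) x∈
          d , choice no-conflict low-risk not-full = choose-colour inv x∈U
          st = place s x d x∈U
      in Step.next st ,
         Placed.Heaviest.heaviest-next st inv x∈U no-conflict low-risk not-full refl
           (λ {y} y∈U → heaviest (subst (y ∈_) eq y∈U)) ,
         step-grows st ,
         trans (cong (_∸ 1) (sym (length-removed st))) (cong (λ us → length us ∸ 1) eq)

    -- A round: one vertex is forced into class `d`, then a heaviest vertex is coloured to restore
    -- slack 0. A round therefore uses up at most two vertices.
    fill : ∀ s d → Invariant s 0 → n ≤ 2 * length (unplaced s) → class-size (placed s) d < q →
           ∃[ s′ ] Invariant s′ 0 × Grows s s′ × class-size (placed s) d < class-size (placed s′) d ×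
           length (unplaced s) ≤ 2 + length (unplaced s′)
    fill s d inv n≤2U not-full =
      let x , x∈U , choice no-conflict low-risk not-full = choose-vertex d inv n≤2U not-full
          st = place s x d x∈U
          s₁ = Step.next st
          s₂ , inv₂ , grows , |U₂| = settle s₁ (Placed.free-next st inv x∈U no-conflict low-risk not-full)
      in s₂ , inv₂ , (λ e → ℕₚ.≤-trans (step-grows st e) (grows e)) ,
         ℕₚ.<-≤-trans (step-fills st) (grows d) ,
         (begin
           length (unplaced s)             ≡⟨ length-removed st ⟩
           1 + length (unplaced s₁)        ≤⟨ s≤s (ℕₚ.m≤n+m∸n (length (unplaced s₁)) 1) ⟩
           2 + (length (unplaced s₁) ∸ 1)  ≡⟨ cong (2 +_) (sym |U₂|) ⟩
           2 + length (unplaced s₂)        ∎)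

    module _ (ℓ : ℕ) (ℓ≤q : ℓ ≤ q) (4Mℓ≤n : 4 * (M * ℓ) ≤ n) where

      -- After m rounds of two placements each.
      Budget : ℕ → State → Set
      Budget m s = n ≤ length (unplaced s) + 2 * m

      -- By induction on the target size `i`; a round is skipped when the class has already reached
      -- it, so `m + i` only bounds the number of rounds from above.
      fill-class : ∀ i s d m → i ≤ ℓ → m + i ≤ M * ℓ → Invariant s 0 → Budget m s →
        ∃[ s′ ] Invariant s′ 0 × Grows s s′ × i ≤ class-size (placed s′) d × Budget (m + i) s′
      fill-class zero    s d m i≤ℓ m+i≤ inv bud =
        s , inv , (λ e → ℕₚ.≤-refl) , z≤n , subst (λ m → Budget m s) (sym (ℕₚ.+-identityʳ m)) bud
      fill-class (suc i) s d m i≤ℓ m+i≤ inv bud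
        with s₁ , inv₁ , grows₁ , i≤size , bud₁ ←
               fill-class i s d m (ℕₚ.<⇒≤ i≤ℓ) (ℕₚ.≤-trans (ℕₚ.+-monoʳ-≤ m (ℕₚ.n≤1+n i)) m+i≤) inv bud
        with suc i ℕₚ.≤? class-size (placed s₁) d
      ... | yes si≤ = s₁ , inv₁ , grows₁ , si≤ ,
                      ℕₚ.≤-trans bud₁ (ℕₚ.+-monoʳ-≤ (length (unplaced s₁)) (ℕₚ.*-monoʳ-≤ 2 (ℕₚ.+-monoʳ-≤ m (ℕₚ.n≤1+n i))))
      ... | no si≰ =
        let s₂ , inv₂ , grows₂ , size< , |U₁| = fill s₁ d inv₁ n≤2U (ℕₚ.<-≤-trans (ℕₚ.≰⇒> si≰) (ℕₚ.≤-trans i≤ℓ ℓ≤q))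
        in s₂ , inv₂ , (λ e → ℕₚ.≤-trans (grows₁ e) (grows₂ e)) , ℕₚ.≤-<-trans i≤size size< ,
           (begin
             n                                             ≤⟨ bud₁ ⟩
             length (unplaced s₁) + 2 * (m + i)            ≤⟨ ℕₚ.+-monoˡ-≤ (2 * (m + i)) |U₁| ⟩
             2 + length (unplaced s₂) + 2 * (m + i)        ≡⟨ lemma₁ (length (unplaced s₂)) m i ⟩
             length (unplaced s₂) + 2 * (m + suc i)        ∎)
        where
        lemma₁ : ∀ u m i → 2 + u + 2 * (m + i) ≡ u + 2 * (m + suc i)
        lemma₁ = solve-∀
        lemma₂ : ∀ u m → 2 * (u + 2 * m) ≡ 2 * u + 4 * m
        lemma₂ = solve-∀
        -- At most M ℓ rounds ever take place, and they colour at most 2 M ℓ ≤ n / 2 vertices.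
        n≤2U : n ≤ 2 * length (unplaced s₁)
        n≤2U = ℕₚ.+-cancelʳ-≤ n n _ (begin
          n + n                                        ≡⟨ cong (n +_) (sym (ℕₚ.+-identityʳ n)) ⟩
          2 * n                                        ≤⟨ ℕₚ.*-monoʳ-≤ 2 bud₁ ⟩
          2 * (length (unplaced s₁) + 2 * (m + i))     ≡⟨ lemma₂ (length (unplaced s₁)) (m + i) ⟩
          2 * length (unplaced s₁) + 4 * (m + i)       ≤⟨ ℕₚ.+-monoʳ-≤ (2 * length (unplaced s₁)) (ℕₚ.≤-trans
                                                            (ℕₚ.*-monoʳ-≤ 4 (ℕₚ.≤-trans (ℕₚ.+-monoʳ-≤ m (ℕₚ.n≤1+n i)) m+i≤)) 4Mℓ≤n) ⟩
          2 * length (unplaced s₁) + n                 ∎)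

      fill-classes : ∀ ds s m → m + length ds * ℓ ≤ M * ℓ → Invariant s 0 → Budget m s →
        ∃[ s′ ] Invariant s′ 0 × Grows s s′ × (∀ {d} → d ∈ ds → ℓ ≤ class-size (placed s′) d)
      fill-classes []       s m m≤ inv bud = s , inv , (λ e → ℕₚ.≤-refl) , λ ()
      fill-classes (d ∷ ds) s m m≤ inv bud =
        let m+ℓ≤ = subst (_≤ M * ℓ) (sym (ℕₚ.+-assoc m ℓ (length ds * ℓ))) m≤
            s₁ , inv₁ , grows₁ , ℓ≤size , bud₁ = fill-class ℓ s d m ℕₚ.≤-refl (ℕₚ.≤-trans (ℕₚ.m≤m+n _ _) m+ℓ≤) inv bud
            s₂ , inv₂ , grows₂ , filled = fill-classes ds s₁ (m + ℓ) m+ℓ≤ inv₁ bud₁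
        in s₂ , inv₂ , (λ e → ℕₚ.≤-trans (grows₁ e) (grows₂ e)) ,
           λ { (here refl) → ℕₚ.≤-trans ℓ≤size (grows₂ d) ; (there d∈ds) → filled d∈ds }

      complete : ∀ m s → length (unplaced s) ≡ m → Invariant s 0 →
        ∃[ s′ ] Invariant s′ 0 × Grows s s′ × unplaced s′ ≡ []
      complete zero    s |U| inv with unplaced s in eq
      ... | [] = s , inv , (λ e → ℕₚ.≤-refl) , eq
      complete (suc m) s |U| inv =
        let s₁ , inv₁ , grows₁ , |U₁| = settle s (weaken inv)
            s₂ , inv₂ , grows₂ , done = complete m s₁ (trans |U₁| (cong (_∸ 1) |U|)) inv₁
        in s₂ , inv₂ , (λ e → ℕₚ.≤-trans (grows₁ e) (grows₂ e)) , done

      initial : State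
      initial = record { unplaced = allFin n ; placed = [] ; partition = ↭-reflexive (Listₚ.++-identityʳ (allFin n)) }

      ∑-zero : ∀ {X : Set} (xs : List X) {f} → (∀ x → f x ≡ 0) → ∑ xs f ≡ 0
      ∑-zero xs f≡0 = trans (∑-cong xs f≡0) (trans (∑-const xs 0) (ℕₚ.*-zeroʳ (length xs)))

      deg-initial : ∀ j c x → deg [] (suc j) c x ≡ 0
      deg-initial j c x = ∑-zero bs (λ B → ℕₚ.*-zeroʳ (χ B x))

      weight-initial : ∀ x → weight [] x ≡ 0
      weight-initial x = cong₂ _+_
        (trans (cong (F *_) (∑-zero colours (λ c → deg-initial (suc k₃) c x))) (ℕₚ.*-zeroʳ F))
        (∑-zero colours (λ c → deg-initial k₃ c x))

      initial-invariant : Invariant initial 0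
      initial-invariant = record
        { capped   = λ d → z≤n
        ; clean    = λ _ c → s≤s z≤n
        ; bounded  = λ c → ℕₚ.≤-trans (ℕₚ.≤-reflexive (∑-zero (allFin n) (deg-initial (suc k₃) c))) z≤n
        ; balanced = λ a {J} uniq J⊆U → ℕₚ.≤-trans (ℕₚ.≤-reflexive (∑-zero J weight-initial)) z≤n
        }

      colouring : ∃[ P ] map proj₁ P ↭ allFin n × (∀ d → ℓ ≤ class-size P d) ×
                  (∀ {B} → B ∈ bs → ∀ c → inside P B c < k)
      colouring =
        let s₁ , inv₁ , grows₁ , filled = fill-classes colours initial 0
              (ℕₚ.≤-reflexive (cong (_* ℓ) (Listₚ.length-tabulate {n = M} id))) initial-invariant
              (ℕₚ.≤-reflexive (sym (trans (ℕₚ.+-identityʳ _) (Listₚ.length-tabulate id))))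
            s₂ , inv₂ , grows₂ , done = complete _ s₁ refl inv₁
        in placed s₂ , subst (λ U → U ++ map proj₁ (placed s₂) ↭ allFin n) done (partition s₂) ,
           (λ d → ℕₚ.≤-trans (filled (∈-allFin d)) (grows₂ d)) , clean inv₂

-- Positions in lists and sequencings

infix 4 _[_]=_

-- Positions are plain natural numbers, so that a position modulo `n` in a list can be moved to its
-- doubled copy and cut into windows without carrying `Fin` bounds.
data _[_]=_ {X : Set} : List X → ℕ → X → Set where
  here  : ∀ {x xs} → (x ∷ xs) [ zero ]= x
  there : ∀ {x y xs i} → xs [ i ]= y → (x ∷ xs) [ suc i ]= y

module _ {X : Set} where

  []=-lookup : ∀ (xs : List X) i → xs [ Fin.toℕ i ]= List.lookup xs i
  []=-lookup (x ∷ xs) Fin.zero    = here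
  []=-lookup (x ∷ xs) (Fin.suc i) = there ([]=-lookup xs i)

  []=-++ˡ : ∀ {xs ys : List X} {i x} → xs [ i ]= x → (xs ++ ys) [ i ]= x
  []=-++ˡ here      = here
  []=-++ˡ (there p) = there ([]=-++ˡ p)

  []=-++ʳ : ∀ (xs : List X) {ys i x} → ys [ i ]= x → (xs ++ ys) [ length xs + i ]= x
  []=-++ʳ []       p = p
  []=-++ʳ (_ ∷ xs) p = there ([]=-++ʳ xs p)

  []=⇒∈ : ∀ {xs : List X} {i x} → xs [ i ]= x → x ∈ xs
  []=⇒∈ here      = here refl
  []=⇒∈ (there p) = there ([]=⇒∈ p)

  []=-window : ∀ {xs : List X} i {j ℓ x} → xs [ i + j ]= x → j < ℓ → x ∈ take ℓ (drop i xs)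
  []=-window zero    {zero}  {suc ℓ} here      j<ℓ       = here refl
  []=-window zero    {suc j} {suc ℓ} (there p) (s≤s j<ℓ) = there ([]=-window zero p j<ℓ)
  []=-window (suc i)                 (there p) j<ℓ       = []=-window i p j<ℓ

  take-++-All : ∀ {p} {Q : X → Set p} {xs ys zs} ℓ → All Q xs → All Q ys → ℓ ≤ length ys → All Q (take ℓ (xs ++ ys ++ zs))
  take-++-All zero    qxs        qys        ℓ≤       = []
  take-++-All (suc ℓ) []         (qy ∷ qys) (s≤s ℓ≤) = qy ∷ take-++-All ℓ [] qys ℓ≤
  take-++-All (suc ℓ) (qx ∷ qxs) qys        ℓ≤       = qx ∷ take-++-All ℓ qxs qys (ℕₚ.<⇒≤ ℓ≤)

  drop-++ˡ : ∀ i (xs : List X) {ys} → i ≤ length xs → drop i (xs ++ ys) ≡ drop i xs ++ ys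
  drop-++ˡ zero    xs       i≤       = refl
  drop-++ˡ (suc i) (x ∷ xs) (s≤s i≤) = drop-++ˡ i xs i≤

  drop-++ʳ : ∀ (xs : List X) {ys} i → drop (length xs + i) (xs ++ ys) ≡ drop i ys
  drop-++ʳ []       i = refl
  drop-++ʳ (_ ∷ xs) i = drop-++ʳ xs i

  unique-index : ∀ {xs : List X} {x} → Unique xs → (p p′ : x ∈ xs) → index p ≡ index p′
  unique-index uniq       (here _)    (here _)     = refl
  unique-index (x∉ ∷ _)   (here refl) (there p′)   = contradiction refl (All.lookup x∉ p′)
  unique-index (x∉ ∷ _)   (there p)   (here refl)  = contradiction refl (All.lookup x∉ p)
  unique-index (_ ∷ uniq) (there p)   (there p′)   = cong Fin.suc (unique-index uniq p p′)

  index-∈-lookup : ∀ (xs : List X) i → index (∈-lookup {xs = xs} i) ≡ i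
  index-∈-lookup (x ∷ xs) Fin.zero    = refl
  index-∈-lookup (x ∷ xs) (Fin.suc i) = cong Fin.suc (index-∈-lookup xs i)

[]=-map⁻ : ∀ {X Y : Set} (f : X → Y) {xs i y} → map f xs [ i ]= y → ∃[ x ] xs [ i ]= x × y ≡ f x
[]=-map⁻ f {x ∷ xs} here      = x , here , refl
[]=-map⁻ f {_ ∷ xs} (there p) with x , q , eq ← []=-map⁻ f p = x , there q , eq

-- Unrolls the cycle: reading cyclically from the first copy, with fewer than two turns in total, is
-- reading the doubled list.
[]=-% : ∀ {X : Set} {xs : List X} {n} .{{_ : NonZero n}} {i x} → length xs ≡ n → i < n + n →
        xs [ i % n ]= x → (xs ++ xs) [ i ]= x
[]=-% {xs = xs} {n} {i} {x} |xs| i<2n p with i ℕₚ.<? n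
... | yes i<n = []=-++ˡ (subst (xs [_]= x) (m<n⇒m%n≡m i<n) p)
... | no  i≮n = subst ((xs ++ xs) [_]= x) i≡ ([]=-++ʳ xs (subst (xs [_]= x) i%n≡ p))
  where
  n≤i : n ≤ i
  n≤i = ℕₚ.≮⇒≥ i≮n
  i≡ : length xs + (i ∸ n) ≡ i
  i≡ = trans (cong (_+ (i ∸ n)) |xs|) (ℕₚ.m+[n∸m]≡n n≤i)
  i%n≡ : i % n ≡ i ∸ n
  i%n≡ = trans (sym (m≤n⇒[n∸m]%m≡n%m n≤i)) (m<n⇒m%n≡m (ℕₚ.+-cancelˡ-< n (i ∸ n) n
    (subst (_< n + n) (sym (ℕₚ.m+[n∸m]≡n n≤i)) i<2n)))

unique-key : ∀ {X Y : Set} {ps : List (X × Y)} {x y y′} → Unique (map proj₁ ps) →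
             (x , y) ∈ ps → (x , y′) ∈ ps → y ≡ y′
unique-key uniq       (here refl) (here refl) = refl
unique-key (x∉ ∷ _)   (here refl) (there p′)  = contradiction refl (All.lookup x∉ (∈-map⁺ proj₁ p′))
unique-key (x∉ ∷ _)   (there p)   (here refl) = contradiction refl (All.lookup x∉ (∈-map⁺ proj₁ p))
unique-key (_ ∷ uniq) (there p)   (there p′)  = unique-key uniq p p′

sequencing : ∀ {n} (xs : List (Fin n)) → xs ↭ allFin n →
             ∃[ φ ] (∀ (i : Fin n) → xs [ Fin.toℕ i ]= (φ ⟨$⟩ʳ i))
sequencing {n} xs xs↭ = permutation to from to∘from from∘to , at
  where
  |xs| : length xs ≡ n
  |xs| = trans (Perm.↭-length xs↭) (Listₚ.length-tabulate id)
  xs-unique : Unique xs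
  xs-unique = unique-resp-↭ (↭-sym xs↭) (Uniqueₚ.allFin⁺ n)
  to : Fin n → Fin n
  to i = List.lookup xs (Fin.cast (sym |xs|) i)
  covered : ∀ v → v ∈ xs
  covered v = Perm.∈-resp-↭ (↭-sym xs↭) (∈-allFin v)
  from : Fin n → Fin n
  from v = Fin.cast |xs| (index (covered v))
  to∘from : ∀ v → to (from v) ≡ v
  to∘from v = trans (cong (List.lookup xs) (Finₚ.cast-involutive (sym |xs|) |xs| (index (covered v)))) (sym (lookup-index (covered v)))
  from∘to : ∀ i → from (to i) ≡ i
  from∘to i = trans (cong (Fin.cast |xs|) (trans
    (unique-index xs-unique (covered (to i)) (∈-lookup (Fin.cast (sym |xs|) i)))
    (index-∈-lookup xs (Fin.cast (sym |xs|) i))))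
    (Finₚ.cast-involutive |xs| (sym |xs|) i)
  at : ∀ i → xs [ Fin.toℕ i ]= to i
  at i = subst (xs [_]= to i) (Finₚ.toℕ-cast (sym |xs|) i) ([]=-lookup xs (Fin.cast (sym |xs|) i))

-- Cyclic arrangement of the colour classes

module Cyclic (M₁ : ℕ) where

  M : ℕ
  M = suc M₁

  prev : Fin M → Fin M
  prev Fin.zero    = Fin.fromℕ M₁
  prev (Fin.suc i) = Fin.inject₁ i

  prev-injective : ∀ {i j} → prev i ≡ prev j → i ≡ j
  prev-injective {Fin.zero}  {Fin.zero}  eq = refl
  prev-injective {Fin.zero}  {Fin.suc j} eq = contradiction eq Finₚ.fromℕ≢inject₁
  prev-injective {Fin.suc i} {Fin.zero}  eq = contradiction (sym eq) Finₚ.fromℕ≢inject₁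
  prev-injective {Fin.suc i} {Fin.suc j} eq = cong Fin.suc (Finₚ.inject₁-injective eq)

  -- Range c consists of the classes c and c + 1 (mod M).
  R : Fin M → Fin M → Bool
  R c e = does (e Fin.≟ c) ∨ does (prev e Fin.≟ c)

  𝟙-∨ : ∀ a b → 𝟙 (a ∨ b) ≤ 𝟙 a + 𝟙 b
  𝟙-∨ true  b = s≤s z≤n
  𝟙-∨ false b = ℕₚ.≤-refl

  ≟-sym : ∀ (e c : Fin M) → does (e Fin.≟ c) ≡ does (c Fin.≟ e)
  ≟-sym e c with e Fin.≟ c | c Fin.≟ e
  ... | yes _   | yes _   = refl
  ... | no _    | no _    = refl
  ... | yes e≡c | no c≢e  = contradiction (sym e≡c) c≢e
  ... | no e≢c  | yes c≡e = contradiction (sym c≡e) e≢c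

  R-row : ∀ c → ∑ (allFin M) (λ e → 𝟙 (R c e)) ≤ 2
  R-row c = begin
    ∑ (allFin M) (λ e → 𝟙 (R c e))
      ≤⟨ ∑-mono (allFin M) (λ {e} _ → 𝟙-∨ (does (e Fin.≟ c)) _) ⟩
    ∑ (allFin M) (λ e → 𝟙 (does (e Fin.≟ c)) + 𝟙 (does (prev e Fin.≟ c)))
      ≡⟨ ∑-+ (allFin M) (λ e → 𝟙 (does (e Fin.≟ c))) _ ⟩
    ∑ (allFin M) (λ e → 𝟙 (does (e Fin.≟ c))) + ∑ (allFin M) (λ e → 𝟙 (does (prev e Fin.≟ c)))
      ≤⟨ ℕₚ.+-mono-≤ (∑-indicator c) (begin
           ∑ (allFin M) (λ e → 𝟙 (does (prev e Fin.≟ c)))         ≡⟨ ∑-map prev (allFin M) _ ⟨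
           ∑ (map prev (allFin M)) (λ e → 𝟙 (does (e Fin.≟ c)))   ≤⟨ unique-∑-≤ _ (Uniqueₚ.map⁺ prev-injective (Uniqueₚ.allFin⁺ M))
                                                                      (λ {e} _ → ∈-allFin e) ⟩
           ∑ (allFin M) (λ e → 𝟙 (does (e Fin.≟ c)))              ≤⟨ ∑-indicator c ⟩
           1                                                      ∎) ⟩
    2 ∎
    where open ℕₚ.≤-Reasoning

  R-column : ∀ e → ∑ (allFin M) (λ c → 𝟙 (R c e)) ≤ 2
  R-column e = begin
    ∑ (allFin M) (λ c → 𝟙 (R c e))
      ≤⟨ ∑-mono (allFin M) (λ {c} _ → ℕₚ.≤-trans (𝟙-∨ (does (e Fin.≟ c)) _)
           (ℕₚ.≤-reflexive (cong₂ (λ u v → 𝟙 u + 𝟙 v) (≟-sym e c) (≟-sym (prev e) c)))) ⟩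
    ∑ (allFin M) (λ c → 𝟙 (does (c Fin.≟ e)) + 𝟙 (does (c Fin.≟ prev e)))
      ≡⟨ ∑-+ (allFin M) (λ c → 𝟙 (does (c Fin.≟ e))) _ ⟩
    ∑ (allFin M) (λ c → 𝟙 (does (c Fin.≟ e))) + ∑ (allFin M) (λ c → 𝟙 (does (c Fin.≟ prev e)))
      ≤⟨ ℕₚ.+-mono-≤ (∑-indicator e) (∑-indicator (prev e)) ⟩
    2 ∎
    where open ℕₚ.≤-Reasoning

  R-self : ∀ c → R c c ≡ true
  R-self c with c Fin.≟ c
  ... | yes _  = refl
  ... | no c≢c = contradiction refl c≢c

  R-next : ∀ {c e} → c ≡ prev e → R c e ≡ true
  R-next {c} {e} refl with prev e Fin.≟ prev e
  ... | yes _ = ∨-zeroʳ (does (e Fin.≟ prev e))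
  ... | no ≢  = contradiction refl ≢

  -- Each colour is the predecessor of the next, and `z` is the colour that follows the last one.
  -- With `z` equal to zero after all colours the circle closes.
  Chain : List (Fin M) → Fin M → Set
  Chain []            z = ⊤
  Chain (c ∷ [])      z = c ≡ prev z
  Chain (c ∷ d ∷ cs)  z = c ≡ prev d × Chain (d ∷ cs) z

  chain-tabulate : ∀ m (f : Fin (suc m) → Fin M) z → (∀ i → f (Fin.inject₁ i) ≡ prev (f (Fin.suc i))) →
                   f (Fin.fromℕ m) ≡ prev z → Chain (tabulate f) z
  chain-tabulate zero    f z steps end = end
  chain-tabulate (suc m) f z steps end = steps Fin.zero , chain-tabulate m (f ∘ Fin.suc) z (steps ∘ Fin.suc) end

  module _ {V : Set} where

    group : List (V × Fin M) → Fin M → List (V × Fin M)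
    group P d = filter (λ (_ , e) → d Fin.≟ e) P

    group-∷-skip : ∀ v e P cs → e ∉ cs → concatMap (group ((v , e) ∷ P)) cs ≡ concatMap (group P) cs
    group-∷-skip v e P []       e∉ = refl
    group-∷-skip v e P (c ∷ cs) e∉ with c Fin.≟ e
    ... | yes refl = contradiction (here refl) e∉
    ... | no _     = cong (group P c ++_) (group-∷-skip v e P cs (e∉ ∘ there))

    group-∷ : ∀ v e P cs → e ∈ cs → Unique cs → concatMap (group ((v , e) ∷ P)) cs ↭ (v , e) ∷ concatMap (group P) cs
    group-∷ v e P (c ∷ cs) e∈ (c∉ ∷ uniq) with c Fin.≟ e
    ... | yes refl = prep _ (Perm.++⁺ˡ (group P c) (↭-reflexive
                       (group-∷-skip v e P cs (λ c∈cs → All.lookup c∉ c∈cs refl))))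
    ... | no c≢e with e∈
    ...   | here e≡c  = contradiction (sym e≡c) c≢e
    ...   | there e∈cs = ↭-trans (Perm.++⁺ˡ (group P c) (group-∷ v e P cs e∈cs uniq)) (Perm.shift _ (group P c) _)

    groups-↭ : ∀ P → concatMap (group P) (allFin M) ↭ P
    groups-↭ []            = ↭-reflexive (none (allFin M))
      where
      none : ∀ cs → concatMap (group []) cs ≡ []
      none []       = refl
      none (c ∷ cs) = none cs
    groups-↭ ((v , e) ∷ P) = ↭-trans (group-∷ v e P (allFin M) (∈-allFin e) (Uniqueₚ.allFin⁺ M)) (prep _ (groups-↭ P))

    module _ (P : List (V × Fin M)) (ℓ : ℕ) (ℓ≤ : ∀ d → ℓ ≤ length (group P d)) where

      Within : Fin M → V × Fin M → Set
      Within c (_ , e) = R c e ≡ true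

      within-self : ∀ c → All (Within c) (group P c)
      within-self c = All.map (λ { refl → R-self c }) (Allₚ.all-filter (λ (_ , e) → c Fin.≟ e) P)

      within-next : ∀ {c d} → c ≡ prev d → All (Within c) (group P d)
      within-next {c} {d} c≡ = All.map (λ { {_ , e} refl → R-next {e = e} c≡ }) (Allₚ.all-filter (λ (_ , e) → d Fin.≟ e) P)

      -- A window that starts in class `c` ends in the following class `d` at the latest, because
      -- `d` alone has at least `ℓ` members.
      two-groups : ∀ i c d rest → c ≡ prev d → i ≤ length (group P c) →
                   All (Within c) (take ℓ (drop i (group P c ++ group P d ++ rest)))
      two-groups i c d rest c≡ i≤ = subst (All (Within c) ∘ take ℓ) (sym (drop-++ˡ i (group P c) i≤))
        (take-++-All ℓ (Allₚ.drop⁺ i (within-self c)) (within-next c≡) (ℓ≤ d))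

      -- Drops whole classes until the start lies in the first one. The class of `z` is kept behind
      -- `cs` so that the last class also has a successor.
      window : ∀ cs z rest → Chain cs z → ∀ i → i < length (concatMap (group P) cs) →
               ∃[ c ] All (Within c) (take ℓ (drop i (concatMap (group P) cs ++ group P z ++ rest)))
      window (c ∷ cs) z rest chain i i< with ℕₚ.≤-<-connex (length (group P c)) i
      window (c ∷ []) z rest chain i i< | inj₁ ≤i =
        contradiction (subst (i <_) (cong length (Listₚ.++-identityʳ (group P c))) i<) (ℕₚ.≤⇒≯ ≤i)
      window (c ∷ []) z rest c≡ i i< | inj₂ i<g =
        c , subst (λ xs → All (Within c) (take ℓ (drop i (xs ++ group P z ++ rest)))) (sym (Listₚ.++-identityʳ (group P c)))
              (two-groups i c z rest c≡ (ℕₚ.<⇒≤ i<g))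
      window (c ∷ d ∷ cs) z rest (c≡ , chain) i i< | inj₂ i<g =
        c , subst (λ xs → All (Within c) (take ℓ (drop i xs)))
              (sym (trans (Listₚ.++-assoc (group P c) _ _) (cong (group P c ++_) (Listₚ.++-assoc (group P d) _ _))))
              (two-groups i c d _ c≡ (ℕₚ.<⇒≤ i<g))
      window (c ∷ d ∷ cs) z rest (c≡ , chain) i i< | inj₁ ≤i
        with e , within ← window (d ∷ cs) z rest chain (i ∸ length (group P c))
               (ℕₚ.+-cancelˡ-< (length (group P c)) _ _ (subst₂ _<_ (sym (ℕₚ.m+[n∸m]≡n ≤i)) (Listₚ.length-++ (group P c)) i<)) =
        e , subst (All (Within e) ∘ take ℓ) (sym (begin
          drop i ((group P c ++ later) ++ end)
            ≡⟨ cong₂ drop (sym (ℕₚ.m+[n∸m]≡n ≤i)) (Listₚ.++-assoc (group P c) later end) ⟩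
          drop (length (group P c) + (i ∸ length (group P c))) (group P c ++ later ++ end)
            ≡⟨ drop-++ʳ (group P c) (i ∸ length (group P c)) ⟩
          drop (i ∸ length (group P c)) (later ++ end) ∎)) within
        where
        open ≡-Reasoning
        later end : List (V × Fin M)
        later = concatMap (group P) (d ∷ cs)
        end = group P z ++ rest

      cyclic-window : let Q = concatMap (group P) (allFin M) in ∀ i → i < length Q →
                      ∃[ c ] All (Within c) (take ℓ (drop i (Q ++ Q)))
      -- The second copy of the list begins with class zero, the cyclic successor of the last class.
      cyclic-window = window (allFin M) Fin.zero (concatMap (group P) (tabulate Fin.suc))
        (chain-tabulate M₁ id Fin.zero (λ _ → refl) refl)

-- From a colouring to a good sequencing

module _ {n k t lam M₁ : ℕ} .{{_ : NonZero n}} (S : PartialSystem n k t lam) where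

  open PartialSystem S using (blocks)
  open Cyclic M₁

  -- A window of `ℓ` vertices lies in one range `c`. A block inside the window would have all its
  -- `k` points in that range, against `clean`.
  colouring⇒good : ∀ ℓ (P : List (Fin n × Fin M)) → map proj₁ P ↭ allFin n →
    (∀ d → ℓ ≤ ∑ P (λ (_ , e) → 𝟙 (does (d Fin.≟ e)))) →
    (∀ {B} → B ∈ blocks → ∀ c → ∑ P (λ (v , e) → 𝟙 (R c e) * χ B v) < k) →
    ∃[ φ ] CyclicallyGood S ℓ φ
  colouring⇒good ℓ P P↭ sizes clean = φ , good
    where
    Q : List (Fin n × Fin M)
    Q = concatMap (group P) (allFin M)
    Q↭P : Q ↭ P
    Q↭P = groups-↭ P
    vs-φ = sequencing (map proj₁ Q) (↭-trans (Perm.map⁺ proj₁ Q↭P) P↭)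
    φ : Sequencing n
    φ = proj₁ vs-φ
    P-unique : Unique (map proj₁ P)
    P-unique = unique-resp-↭ (↭-sym P↭) (Uniqueₚ.allFin⁺ n)
    |Q| : length Q ≡ n
    |Q| = trans (sym (Listₚ.length-map proj₁ Q)) (trans (Perm.↭-length (↭-trans (Perm.map⁺ proj₁ Q↭P) P↭)) (Listₚ.length-tabulate id))
    ℓ≤group : ∀ d → ℓ ≤ length (group P d)
    ℓ≤group d = subst (ℓ ≤_) (sym (length-filter (λ (_ , e) → d Fin.≟ e) P)) (sizes d)
    good : CyclicallyGood S ℓ φ
    good Y |Y|≡ℓ (i , Y⇔) = All.tabulate λ {B} B∈blocks B⊆Y →
      contradiction (clean B∈blocks c) (ℕₚ.≤⇒≯ (begin
        k                                        ≡⟨ sym (All.lookup (PartialSystem.block-size S) B∈blocks) ⟩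
        ∣ B ∣                                    ≡⟨ sym (∑-χ B) ⟩
        ∑ (allFin n) (χ B)                       ≡⟨ sym (∑-↭ (χ B) P↭) ⟩
        ∑ (map proj₁ P) (χ B)                    ≡⟨ ∑-map proj₁ P (χ B) ⟩
        ∑ P (λ (v , e) → χ B v)                  ≤⟨ ∑-mono P (λ {(v , e)} → covered B B⊆Y v e) ⟩
        ∑ P (λ (v , e) → 𝟙 (R c e) * χ B v)      ∎))
      where
      open ℕₚ.≤-Reasoning
      win = cyclic-window P ℓ ℓ≤group (Fin.toℕ i) (subst (Fin.toℕ i <_) (sym |Q|) (Finₚ.toℕ<n i))
      c : Fin M
      c = proj₁ win
      covered : ∀ B → B ⊆ Y → ∀ v e → (v , e) ∈ P → χ B v ≤ 𝟙 (R c e) * χ B v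
      covered B B⊆Y v e ve∈P with lookup B v in Bv
      ... | false = z≤n
      ... | true
        with j , j<|Y| , refl ← Equivalence.to (Y⇔ v) (B⊆Y (lookup⇒[]= v B Bv))
        with (_ , e′) , at , refl ← []=-map⁻ proj₁ {xs = Q} (proj₂ vs-φ ((Fin.toℕ i + j) mod n))
        = ℕₚ.≤-reflexive (sym (trans (ℕₚ.*-identityʳ _) (cong 𝟙 Rce)))
        where
        j<ℓ : j < ℓ
        j<ℓ = subst (j <_) |Y|≡ℓ j<|Y|
        entry : Fin n × Fin M
        entry = φ ⟨$⟩ʳ ((Fin.toℕ i + j) mod n) , e′
        at′ : Q [ (Fin.toℕ i + j) % n ]= entry
        at′ = subst (Q [_]= entry) (Finₚ.toℕ-fromℕ< (m%n<n (Fin.toℕ i + j) n)) at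
        ℓ≤n : ℓ ≤ n
        ℓ≤n = subst (_≤ n) |Y|≡ℓ (Sub.∣p∣≤n Y)
        Rce′ : R c e′ ≡ true
        -- As j < ℓ ≤ n, the position i + j is below 2 n and can be read in `Q ++ Q`.
        Rce′ = All.lookup (proj₂ win) ([]=-window (Fin.toℕ i)
          ([]=-% |Q| (ℕₚ.+-mono-<-≤ (Finₚ.toℕ<n i) (ℕₚ.≤-trans (ℕₚ.<⇒≤ j<ℓ) ℓ≤n)) at′) j<ℓ)
        Rce : R c e ≡ true
        Rce = trans (cong (R c) (unique-key P-unique ve∈P (Perm.∈-resp-↭ Q↭P ([]=⇒∈ at)))) Rce′

-- Numerical estimates and the choice of parameters

^-distribʳ-* : ∀ t a b → (a * b) ^ t ≡ a ^ t * b ^ t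
^-distribʳ-* zero    a b = refl
^-distribʳ-* (suc t) a b = trans (cong (a * b *_) (^-distribʳ-* t a b)) (lemma a b (a ^ t) (b ^ t))
  where
  lemma : ∀ a b p q → a * b * (p * q) ≡ a * p * (b * q)
  lemma = solve-∀

n<2^n : ∀ n → n < 2 ^ n
n<2^n zero    = s≤s z≤n
n<2^n (suc n) = begin-strict
  suc n            ≡⟨ ℕₚ.+-comm 1 n ⟩
  n + 1            <⟨ ℕₚ.+-mono-<-≤ (n<2^n n) (ℕₚ.m^n>0 2 n) ⟩
  2 ^ n + 2 ^ n    ≡⟨ cong (2 ^ n +_) (ℕₚ.+-identityʳ (2 ^ n)) ⟨
  2 ^ suc n        ∎
  where open ℕₚ.≤-Reasoning

between-powers : ∀ n .{{_ : NonZero n}} → ∃[ b ] 2 ^ b ≤ n × n < 2 ^ suc b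
between-powers (suc zero)    = 0 , ℕₚ.≤-refl , ℕₚ.≤-refl
between-powers (suc (suc n)) with b , 2^b≤ , <2^sb ← between-powers (suc n)
  with ℕₚ.m≤n⇒m<n∨m≡n <2^sb
... | inj₁ lt = b , ℕₚ.m≤n⇒m≤1+n 2^b≤ , lt
... | inj₂ eq = suc b , ℕₚ.≤-reflexive (sym eq) , subst (_< 2 ^ (2 + b)) (sym eq) (ℕₚ.^-monoʳ-< 2 (s≤s (s≤s z≤n)) (ℕₚ.n<1+n (suc b)))

-- With y = ⌊b / 8⌋ one has b + 3 ≤ 11 (y + 1) and (y + 1)⁸ ≤ 2ᵇ.
quartic≤exponential : ∀ D → ∃[ b₀ ] (∀ b → b₀ ≤ b → D * (b + 3) ^ 4 ≤ 2 ^ b)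
quartic≤exponential D = 8 * D′ , bound
  where
  open ℕₚ.≤-Reasoning
  D′ : ℕ
  D′ = D * 11 ^ 4
  bound : ∀ b → 8 * D′ ≤ b → D * (b + 3) ^ 4 ≤ 2 ^ b
  bound b 8D′≤b = begin
    D * (b + 3) ^ 4                 ≤⟨ ℕₚ.*-monoʳ-≤ D (ℕₚ.^-monoˡ-≤ 4 b+3≤) ⟩
    D * (11 * suc y) ^ 4            ≡⟨ cong (D *_) (^-distribʳ-* 4 11 (suc y)) ⟩
    D * (11 ^ 4 * suc y ^ 4)        ≡⟨ ℕₚ.*-assoc D (11 ^ 4) (suc y ^ 4) ⟨
    D′ * suc y ^ 4                  ≤⟨ ℕₚ.*-monoˡ-≤ (suc y ^ 4) (ℕₚ.≤-trans D′≤y (ℕₚ.≤-trans (ℕₚ.n≤1+n y) (ℕₚ.m≤m*n (suc y) (suc y ^ 3) {{ℕₚ.m^n≢0 (suc y) 3}}))) ⟩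
    suc y ^ 4 * suc y ^ 4           ≡⟨ ℕₚ.^-distribˡ-+-* (suc y) 4 4 ⟨
    suc y ^ 8                       ≤⟨ ℕₚ.^-monoˡ-≤ 8 (n<2^n y) ⟩
    (2 ^ y) ^ 8                     ≡⟨ ℕₚ.^-*-assoc 2 y 8 ⟩
    2 ^ (y * 8)                     ≤⟨ ℕₚ.^-monoʳ-≤ 2 (m/n*n≤m b 8) ⟩
    2 ^ b                           ∎
    where
    y : ℕ
    y = b / 8
    D′≤y : D′ ≤ y
    D′≤y = subst (_≤ y) (trans (cong (_/ 8) (ℕₚ.*-comm 8 D′)) (m*n/n≡m D′ 8)) (/-monoˡ-≤ 8 8D′≤b)
    lemma : ∀ y → 8 + y * 8 + 3 + y * 3 ≡ 11 * suc y
    lemma = solve-∀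
    b+3≤ : b + 3 ≤ 11 * suc y
    b+3≤ = begin
      b + 3                    ≡⟨ cong (_+ 3) (m≡m%n+[m/n]*n b 8) ⟩
      b % 8 + y * 8 + 3        ≤⟨ ℕₚ.+-monoˡ-≤ 3 (ℕₚ.+-monoˡ-≤ (y * 8) (ℕₚ.<⇒≤ (m%n<n b 8))) ⟩
      8 + y * 8 + 3            ≤⟨ ℕₚ.m≤m+n _ (y * 3) ⟩
      8 + y * 8 + 3 + y * 3    ≡⟨ lemma y ⟩
      11 * suc y               ∎

-- Otherwise n < 4 X ℓ, and squaring contradicts ℓ² ≤ K n. Thus the number of colours has at least
-- the order of √n, well above every power of log n.
many-colours : ∀ n ℓ K X .{{_ : NonZero n}} .{{_ : NonZero ℓ}} .{{_ : NonZero (4 * ℓ)}} →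
               ℓ * ℓ ≤ K * n → 16 * K * (X * X) ≤ n → X ≤ n / (4 * ℓ)
many-colours n ℓ K X ℓ²≤Kn 16KX²≤n = ℕₚ.≮⇒≥ λ m<X → ℕₚ.<-irrefl refl (begin-strict
  n * n                              <⟨ ℕₚ.*-mono-< (n<X4ℓ m<X) (n<X4ℓ m<X) ⟩
  X * (4 * ℓ) * (X * (4 * ℓ))        ≡⟨ lemma₁ X ℓ ⟩
  16 * (X * X) * (ℓ * ℓ)             ≤⟨ ℕₚ.*-monoʳ-≤ (16 * (X * X)) ℓ²≤Kn ⟩
  16 * (X * X) * (K * n)             ≡⟨ lemma₂ X K n ⟩
  16 * K * (X * X) * n               ≤⟨ ℕₚ.*-monoˡ-≤ n 16KX²≤n ⟩
  n * n                              ∎)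
  where
  open ℕₚ.≤-Reasoning
  n<X4ℓ : n / (4 * ℓ) < X → n < X * (4 * ℓ)
  n<X4ℓ m<X = begin-strict
    n                                          ≡⟨ m≡m%n+[m/n]*n n (4 * ℓ) ⟩
    n % (4 * ℓ) + n / (4 * ℓ) * (4 * ℓ)        <⟨ ℕₚ.+-monoˡ-< (n / (4 * ℓ) * (4 * ℓ)) (m%n<n n (4 * ℓ)) ⟩
    suc (n / (4 * ℓ)) * (4 * ℓ)                ≤⟨ ℕₚ.*-monoˡ-≤ (4 * ℓ) m<X ⟩
    X * (4 * ℓ)                                ∎
  lemma₁ : ∀ X l → X * (4 * l) * (X * (4 * l)) ≡ 16 * (X * X) * (l * l)
  lemma₁ = solve-∀
  lemma₂ : ∀ X K n → 16 * (X * X) * (K * n) ≡ 16 * K * (X * X) * n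
  lemma₂ = solve-∀

-- C, F and q are given by equations, not definitions, so that the numerals in them are never unfolded.
module Parameters (k₃ t₂ lam K n ℓ M b C F q : ℕ) .{{_ : NonZero lam}} .{{_ : NonZero K}}
  .{{_ : NonZero n}} .{{_ : NonZero ℓ}}
  (C≡ : C ≡ 8 * (lam * (K * 64 ^ suc t₂))) (F≡ : F ≡ 96 * ((3 + k₃) * (C * (b + 2)))) (q≡ : q ≡ 32 * ℓ) where

  open ℕₚ.≤-Reasoning

  t₁ k β G : ℕ
  t₁ = suc t₂
  k = 3 + k₃
  β = b + 2
  G = lam * (q + q) ^ t₁

  instance
    C≢0 : NonZero C
    C≢0 = subst NonZero (sym C≡) (ℕₚ.m*n≢0 8 (lam * (K * 64 ^ t₁)) {{it}}
      {{ℕₚ.m*n≢0 lam (K * 64 ^ t₁) {{it}} {{ℕₚ.m*n≢0 K (64 ^ t₁) {{it}} {{ℕₚ.m^n≢0 64 t₁}}}}}})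
    β≢0 : NonZero β
    β≢0 = >-nonZero (ℕₚ.≤-trans (s≤s z≤n) (ℕₚ.m≤n+m 2 b))
    F≢0 : NonZero F
    F≢0 = subst NonZero (sym F≡) (ℕₚ.m*n≢0 96 (k * (C * β)) {{it}} {{ℕₚ.m*n≢0 k (C * β) {{it}} {{ℕₚ.m*n≢0 C β}}}})
    q≢0 : NonZero q
    q≢0 = subst NonZero (sym q≡) (ℕₚ.m*n≢0 32 ℓ)

  ℓ≤q : ℓ ≤ q
  ℓ≤q = subst (ℓ ≤_) (sym q≡) (ℕₚ.m≤m+n ℓ (31 * ℓ))

  2≤β : 2 ≤ β
  2≤β = ℕₚ.m≤n+m 2 b

  q+q≡64ℓ : q + q ≡ 64 * ℓ
  q+q≡64ℓ = trans (cong₂ _+_ q≡ q≡) (lemma ℓ)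
    where
    lemma : ∀ l → 32 * l + 32 * l ≡ 64 * l
    lemma = solve-∀

  module _ (ℓ^t≤Kn : ℓ ^ suc t₁ ≤ K * n) (4Mℓ≤n : 4 * (M * ℓ) ≤ n) (n≤8Mℓ : n ≤ 8 * (M * ℓ))
    (enough : 48 * (k * (F * β)) ≤ M) where

    -- The capacity 32 ℓ is four times 8 ℓ, an upper bound for the average class size n / M.
    4n≤Mq : 4 * n ≤ M * q
    4n≤Mq = ℕₚ.≤-trans (ℕₚ.*-monoʳ-≤ 4 n≤8Mℓ) (ℕₚ.≤-reflexive (trans (lemma M ℓ) (cong (M *_) (sym q≡))))
      where
      lemma : ∀ M l → 4 * (8 * (M * l)) ≡ M * (32 * l)
      lemma = solve-∀

    -- From ℓᵗ ≤ K n ≤ 8 K M ℓ one factor `ℓ` cancels, leaving ℓᵗ⁻¹ ≤ 8 K M; `C` collects the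
    -- constants.
    G≤CM : G ≤ C * M
    G≤CM = ℕₚ.*-cancelʳ-≤ G (C * M) ℓ (begin
      lam * (q + q) ^ t₁ * ℓ                     ≡⟨ cong (λ e → lam * e ^ t₁ * ℓ) q+q≡64ℓ ⟩
      lam * (64 * ℓ) ^ t₁ * ℓ                    ≡⟨ cong (λ e → lam * e * ℓ) (^-distribʳ-* t₁ 64 ℓ) ⟩
      lam * (64 ^ t₁ * ℓ ^ t₁) * ℓ               ≡⟨ lemma₁ lam (64 ^ t₁) (ℓ ^ t₁) ℓ ⟩
      lam * 64 ^ t₁ * (ℓ * ℓ ^ t₁)               ≤⟨ ℕₚ.*-monoʳ-≤ (lam * 64 ^ t₁) (ℕₚ.≤-trans ℓ^t≤Kn (ℕₚ.*-monoʳ-≤ K n≤8Mℓ)) ⟩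
      lam * 64 ^ t₁ * (K * (8 * (M * ℓ)))        ≡⟨ lemma₂ lam (64 ^ t₁) K M ℓ ⟩
      8 * (lam * (K * 64 ^ t₁)) * M * ℓ          ≡⟨ cong (λ c → c * M * ℓ) C≡ ⟨
      C * M * ℓ                                  ∎)
      where
      lemma₁ : ∀ a s p l → a * (s * p) * l ≡ a * s * (l * p)
      lemma₁ = solve-∀
      lemma₂ : ∀ a s K M l → a * s * (K * (8 * (M * l))) ≡ 8 * (a * (K * s)) * M * l
      lemma₂ = solve-∀

    -- After doubling, the part quadratic in `F` is at most M F by `enough`. The part with `G` is at
    -- most 96 k C β M, and `F` is defined as 96 k C β precisely to make this M F.
    few : 8 * (3 * (F * (k * F) + 2 * (k * G)) * (b + 2)) ≤ M * F
    few = ℕₚ.*-cancelˡ-≤ 2 (begin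
      2 * (8 * (3 * (F * (k * F) + 2 * (k * G)) * β))      ≡⟨ lemma₁ F k G β ⟩
      48 * (k * (F * β)) * F + 96 * (k * (G * β))          ≤⟨ ℕₚ.+-mono-≤ (ℕₚ.*-monoˡ-≤ F enough)
                                                                (ℕₚ.*-monoʳ-≤ 96 (ℕₚ.*-monoʳ-≤ k (ℕₚ.*-monoˡ-≤ β G≤CM))) ⟩
      M * F + 96 * (k * (C * M * β))                       ≡⟨ cong (λ f → M * f + 96 * (k * (C * M * β))) F≡ ⟩
      M * (96 * (k * (C * β))) + 96 * (k * (C * M * β))    ≡⟨ lemma₂ M k C β ⟩
      2 * (M * (96 * (k * (C * β))))                       ≡⟨ cong (λ f → 2 * (M * f)) F≡ ⟨
      2 * (M * F)                                          ∎)
      where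
      lemma₁ : ∀ F k G β → 2 * (8 * (3 * (F * (k * F) + 2 * (k * G)) * β)) ≡ 48 * (k * (F * β)) * F + 96 * (k * (G * β))
      lemma₁ = solve-∀
      lemma₂ : ∀ M k C β → M * (96 * (k * (C * β))) + 96 * (k * (C * M * β)) ≡ 2 * (M * (96 * (k * (C * β))))
      lemma₂ = solve-∀

    room₁ : 6 * (4 * (F * (k * F * (q + q)))) ≤ 4 * (n * F)
    room₁ = begin
      6 * (4 * (F * (k * F * (q + q))))     ≡⟨ cong (λ e → 6 * (4 * (F * (k * F * e)))) q+q≡64ℓ ⟩
      6 * (4 * (F * (k * F * (64 * ℓ))))    ≡⟨ lemma₁ F k ℓ ⟩
      4 * (4 * (48 * (k * (F * 2)) * ℓ) * F)  ≤⟨ ℕₚ.*-monoʳ-≤ 4 (ℕₚ.*-monoˡ-≤ F (ℕₚ.*-monoʳ-≤ 4 (ℕₚ.*-monoˡ-≤ ℓ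
                                                 (ℕₚ.≤-trans (ℕₚ.*-monoʳ-≤ 48 (ℕₚ.*-monoʳ-≤ k (ℕₚ.*-monoʳ-≤ F 2≤β))) enough)))) ⟩
      4 * (4 * (M * ℓ) * F)                 ≤⟨ ℕₚ.*-monoʳ-≤ 4 (ℕₚ.*-monoˡ-≤ F 4Mℓ≤n) ⟩
      4 * (n * F)                           ∎
      where
      lemma₁ : ∀ F k l → 6 * (4 * (F * (k * F * (64 * l)))) ≡ 4 * (4 * (48 * (k * (F * 2)) * l) * F)
      lemma₁ = solve-∀

    room₂ : 6 * (4 * (k * (lam * (q + q) ^ suc t₁))) ≤ n * F
    room₂ = begin
      6 * (4 * (k * (lam * (q + q) ^ suc t₁)))               ≡⟨ cong (λ e → 6 * (4 * (k * (lam * e ^ suc t₁)))) q+q≡64ℓ ⟩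
      6 * (4 * (k * (lam * (64 * ℓ) ^ suc t₁)))              ≡⟨ cong (λ e → 6 * (4 * (k * (lam * e)))) (^-distribʳ-* (suc t₁) 64 ℓ) ⟩
      6 * (4 * (k * (lam * (64 * 64 ^ t₁ * ℓ ^ suc t₁))))    ≤⟨ ℕₚ.*-monoʳ-≤ 6 (ℕₚ.*-monoʳ-≤ 4 (ℕₚ.*-monoʳ-≤ k (ℕₚ.*-monoʳ-≤ lam
                                                                  (ℕₚ.*-monoʳ-≤ (64 * 64 ^ t₁) ℓ^t≤Kn)))) ⟩
      6 * (4 * (k * (lam * (64 * 64 ^ t₁ * (K * n)))))       ≡⟨ lemma k lam (64 ^ t₁) K n ⟩
      n * (96 * (k * (8 * (lam * (K * 64 ^ t₁)) * 2)))       ≡⟨ cong (λ c → n * (96 * (k * (c * 2)))) C≡ ⟨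
      n * (96 * (k * (C * 2)))                               ≤⟨ ℕₚ.*-monoʳ-≤ n (ℕₚ.*-monoʳ-≤ 96 (ℕₚ.*-monoʳ-≤ k (ℕₚ.*-monoʳ-≤ C 2≤β))) ⟩
      n * (96 * (k * (C * β)))                               ≡⟨ cong (n *_) F≡ ⟨
      n * F                                                  ∎
      where
      lemma : ∀ k a s K n → 6 * (4 * (k * (a * (64 * s * (K * n))))) ≡ n * (96 * (k * (8 * (a * (K * s)) * 2)))
      lemma = solve-∀

    -- The two summands take at most four sixths and one sixth of n F, so strictness comes from the
    -- remaining sixth.
    room : 4 * (F * (k * F * (q + q))) + 4 * (k * (lam * (q + q) ^ suc t₁)) < n * F
    room = ℕₚ.*-cancelˡ-< 6 _ _ (begin-strict
      6 * (u + v)             ≡⟨ ℕₚ.*-distribˡ-+ 6 u v ⟩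
      6 * u + 6 * v           ≤⟨ ℕₚ.+-mono-≤ room₁ room₂ ⟩
      4 * (n * F) + n * F     ≡⟨ ℕₚ.+-comm (4 * (n * F)) (n * F) ⟩
      5 * (n * F)             <⟨ ℕₚ.*-monoˡ-< (n * F) {{ℕₚ.m*n≢0 n F}} (ℕₚ.n<1+n 5) ⟩
      6 * (n * F)             ∎)
      where
      u v : ℕ
      u = 4 * (F * (k * F * (q + q)))
      v = 4 * (k * (lam * (q + q) ^ suc t₁))

-- From the real bound on ℓ to an inequality between natural numbers

module ℚ^ = Exp (CommutativeRing.commutativeSemiring ℚₚ.+-*-commutativeRing)

/1-+ : ∀ m n → m /1 ℚ.+ n /1 ≡ (m + n) /1
/1-+ zero    n = ℚₚ.+-identityˡ (n /1)
/1-+ (suc m) n = begin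
  suc m /1 ℚ.+ n /1           ≡⟨ cong (ℚ._+ n /1) (1+n/1 m) ⟨
  1ℚ ℚ.+ m /1 ℚ.+ n /1        ≡⟨ ℚₚ.+-assoc 1ℚ (m /1) (n /1) ⟩
  1ℚ ℚ.+ (m /1 ℚ.+ n /1)      ≡⟨ cong (1ℚ ℚ.+_) (/1-+ m n) ⟩
  1ℚ ℚ.+ (m + n) /1           ≡⟨ 1+n/1 (m + n) ⟩
  suc (m + n) /1              ∎
  where open ≡-Reasoning

/1-* : ∀ m n → m /1 ℚ.* n /1 ≡ (m * n) /1
/1-* zero    n = ℚₚ.*-zeroˡ (n /1)
/1-* (suc m) n = begin
  suc m /1 ℚ.* n /1                  ≡⟨ cong (ℚ._* n /1) (1+n/1 m) ⟨
  (1ℚ ℚ.+ m /1) ℚ.* n /1             ≡⟨ ℚₚ.*-distribʳ-+ (n /1) 1ℚ (m /1) ⟩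
  1ℚ ℚ.* n /1 ℚ.+ m /1 ℚ.* n /1      ≡⟨ cong₂ ℚ._+_ (ℚₚ.*-identityˡ (n /1)) (/1-* m n) ⟩
  n /1 ℚ.+ (m * n) /1                ≡⟨ /1-+ n (m * n) ⟩
  (n + m * n) /1                     ∎
  where open ≡-Reasoning

/1-^ : ∀ m t → (m /1) ^ℚ t ≡ (m ^ t) /1
/1-^ m zero    = refl
/1-^ m (suc t) = trans (cong (m /1 ℚ.*_) (/1-^ m t)) (/1-* m (m ^ t))

/1-cancel-< : ∀ {m n} → m /1 ℚ.< n /1 → m < n
/1-cancel-< {m} {n} m<n = ℤₚ.drop‿+<+ (subst₂ ℤ._<_ (ℤₚ.*-identityʳ (ℤ.+ m)) (ℤₚ.*-identityʳ (ℤ.+ n)) (ℚₚ.drop-*<* m<n))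

0</1 : ∀ m .{{_ : NonZero m}} → 0ℚ ℚ.< m /1
0</1 (suc m) = ℚₚ.positive⁻¹ (suc m /1)

-- Testing the comparison at ℓ / 2, which lies below ℓ, costs only a factor 2ᵗ.
root-bound : ∀ (α : ℝ⁺) t .{{_ : NonZero t}} → ∃[ K ] NonZero K ×
             (∀ n ℓ .{{_ : NonZero n}} .{{_ : NonZero ℓ}} → fromℕ⁺ ℓ ≤ᴿ α *ᴿ fromℕ⁺ n ^1/ t → ℓ ^ t ≤ K * n)
root-bound α t = (A + A) ^ t , ℕₚ.m^n≢0 (A + A) t , bound
  where
  open ℚₚ.≤-Reasoning
  q = proj₁ (ℝ⁺.bounded α)
  A = proj₁ (<-suc/1 q)
  αA : ℝ⁺.Upper α (A /1)
  αA = ℝ⁺.upper-closed α (proj₂ (<-suc/1 q)) (proj₂ (ℝ⁺.bounded α))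
  instance
    A+A≢0 : NonZero (A + A)
    A+A≢0 = >-nonZero (ℕₚ.≤-trans (/1-cancel-< (ℝ⁺.upper⇒0< α αA)) (ℕₚ.m≤m+n A A))
  bound : ∀ n ℓ .{{_ : NonZero n}} .{{_ : NonZero ℓ}} → fromℕ⁺ ℓ ≤ᴿ α *ᴿ fromℕ⁺ n ^1/ t → ℓ ^ t ≤ (A + A) ^ t * n
  bound n ℓ ℓ≤ with ℓ≤ half half<ℓ
    where
    half : ℚ
    half = ℚ.½ ℚ.* ℓ /1
    half<ℓ : half ℚ.< ℤ.+ ℓ ℚ./ 1
    half<ℓ = subst₂ ℚ._<_ refl (trans (ℚₚ.*-identityˡ (ℓ /1)) (sym (ℚₚ.↥p/↧p≡p (ℓ /1))))
      (ℚₚ.*-monoˡ-<-pos (ℓ /1) {{ℚ.positive (0</1 ℓ)}} {ℚ.½} {1ℚ} (toWitness {a? = ℚ.½ ℚₚ.<? 1ℚ} _))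
  -- Here a < A since `A` lies above α, and b < c with cᵗ < n. Hence ℓ / 2 < A c, so ℓ < 2 A c, and
  -- the t-th power gives the constant (2 A)ᵗ.
  ... | a , b , 0<a , 0<b , αa , (c , 0<c , b<c , cᵗ<n) , half<ab = ℕₚ.<⇒≤ (/1-cancel-< (begin-strict
    (ℓ ^ t) /1                              ≡⟨ /1-^ ℓ t ⟨
    (ℓ /1) ^ℚ t                             <⟨ ^-mono-< t (0</1 ℓ) ℓ<2Ac ⟩
    ((A + A) /1 ℚ.* c) ^ℚ t                 ≡⟨ ℚ^.^-distrib-* ((A + A) /1) c t ⟩
    ((A + A) /1) ^ℚ t ℚ.* c ^ℚ t            <⟨ ℚₚ.*-monoʳ-<-pos (((A + A) /1) ^ℚ t) {{ℚ.positive (^-pos t (0</1 (A + A)))}}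
                                                 (subst (c ^ℚ t ℚ.<_) (ℚₚ.↥p/↧p≡p (n /1)) cᵗ<n) ⟩
    ((A + A) /1) ^ℚ t ℚ.* n /1              ≡⟨ cong (ℚ._* n /1) (/1-^ (A + A) t) ⟩
    ((A + A) ^ t) /1 ℚ.* n /1               ≡⟨ /1-* ((A + A) ^ t) n ⟩
    ((A + A) ^ t * n) /1                    ∎))
    where
    half<Ac : ℚ.½ ℚ.* ℓ /1 ℚ.< A /1 ℚ.* c
    half<Ac = ℚₚ.<-trans half<ab (*-mono-<-pos 0<a (ℝ⁺.lower<upper α αa αA) 0<b b<c)
    ℓ<2Ac : ℓ /1 ℚ.< (A + A) /1 ℚ.* c
    ℓ<2Ac = subst₂ ℚ._<_
      (trans (sym (ℚₚ.*-distribʳ-+ (ℓ /1) ℚ.½ ℚ.½)) (ℚₚ.*-identityˡ (ℓ /1)))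
      (trans (sym (ℚₚ.*-distribʳ-+ c (A /1) (A /1))) (cong (ℚ._* c) (/1-+ A A)))
      (ℚₚ.+-mono-< half<Ac half<Ac)

-- Assembly for all sufficiently large n

good-sequencing : ∀ k₃ t₂ lam K n ℓ M₁ b C F q .{{_ : NonZero lam}} .{{_ : NonZero K}} .{{_ : NonZero n}} .{{_ : NonZero ℓ}} →
  C ≡ 8 * (lam * (K * 64 ^ suc t₂)) → F ≡ 96 * ((3 + k₃) * (C * (b + 2))) → q ≡ 32 * ℓ →
  suc t₂ ≤ k₃ → (S : PartialSystem n (3 + k₃) (2 + t₂) lam) →
  ℓ ^ (2 + t₂) ≤ K * n → n ≤ 2 ^ b → 4 * (suc M₁ * ℓ) ≤ n → n ≤ 8 * (suc M₁ * ℓ) →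
  48 * ((3 + k₃) * (F * (b + 2))) ≤ suc M₁ →
  ∃[ φ ] CyclicallyGood S ℓ φ
good-sequencing k₃ t₂ lam K n ℓ M₁ b C F q C≡ F≡ q≡ t₁≤k₃ S ℓᵗ≤Kn n≤2^b 4Mℓ≤n n≤8Mℓ enough =
  let P , P↭ , sizes , clean = coloured in colouring⇒good S ℓ P P↭ sizes clean
  where
  open PartialSystem S using (blocks)
  open Cyclic M₁ using (R; R-row; R-column)
  open Parameters k₃ t₂ lam K n ℓ (suc M₁) b C F q C≡ F≡ q≡
  balance : ∀ T → ∣ T ∣ ≡ 2 + t₂ → ∑ blocks (contains T) ≤ lam
  balance T |T| = subst (_≤ lam) (length-filter (T Sub.⊆?_) blocks) (PartialSystem.balance S T |T|)
  open Process blocks k₃ t₁ lam (suc M₁) t₁≤k₃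
    (λ B∈ → ℕₚ.≤-reflexive (All.lookup (PartialSystem.block-size S) B∈)) balance R R-row R-column
    q F b n≤2^b (4n≤Mq ℓᵗ≤Kn 4Mℓ≤n n≤8Mℓ enough)
  coloured = Steps.colouring (few ℓᵗ≤Kn 4Mℓ≤n n≤8Mℓ enough) (room ℓᵗ≤Kn 4Mℓ≤n n≤8Mℓ enough) ℓ ℓ≤q 4Mℓ≤n

threshold-scale : ∀ k C E F c → E ≡ 48 * (k * (96 * (k * C))) → F ≡ 96 * (k * (C * c)) → 48 * (k * (F * c)) ≡ E * (c * c)
threshold-scale k C _ _ c refl refl = lemma k C c
  where
  lemma : ∀ k C c → 48 * (k * (96 * (k * (C * c)) * c)) ≡ 48 * (k * (96 * (k * C))) * (c * c)
  lemma = solve-∀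

square-scale : ∀ K E D c → D ≡ 16 * K * (E * E) → 16 * K * (E * (c * c) * (E * (c * c))) ≡ D * c ^ 4
square-scale K E _ c refl = lemma K E c
  where
  lemma : ∀ K E c → 16 * K * (E * (c * c) * (E * (c * c))) ≡ 16 * K * (E * E) * (c * (c * (c * (c * 1))))
  lemma = solve-∀

-- With 2ᵇ ≤ n < 2ᵇ⁺¹ and β = b + 3, the process asks for E β² colours. By `many-colours` it
-- suffices that D β⁴ ≤ n, which holds once `b` is at least `b₀`.
large-systems : ∀ k₃ t₂ lam K C E D F b₀ b .{{_ : NonZero lam}} .{{_ : NonZero K}} .{{_ : NonZero E}} →
  C ≡ 8 * (lam * (K * 64 ^ suc t₂)) → E ≡ 48 * ((3 + k₃) * (96 * ((3 + k₃) * C))) → D ≡ 16 * K * (E * E) →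
  F ≡ 96 * ((3 + k₃) * (C * (suc b + 2))) → (∀ b → b₀ ≤ b → D * (b + 3) ^ 4 ≤ 2 ^ b) → suc t₂ ≤ k₃ →
  ∀ n .{{_ : NonZero n}} → 2 ^ b₀ ≤ n → 2 ^ b ≤ n → n < 2 ^ suc b → (S : PartialSystem n (3 + k₃) (2 + t₂) lam) →
  ∀ ℓ .{{_ : NonZero ℓ}} → ℓ ^ (2 + t₂) ≤ K * n → ∃[ φ ] CyclicallyGood S ℓ φ
large-systems k₃ t₂ lam K C E D F b₀ b C≡ E≡ D≡ F≡ grows t₁≤k₃ n 2^b₀≤n 2^b≤n n<2^sb S ℓ ℓᵗ≤Kn =
    good-sequencing k₃ t₂ lam K n ℓ M₁ (suc b) C F (32 * ℓ) C≡ F≡ refl t₁≤k₃ S ℓᵗ≤Kn (ℕₚ.<⇒≤ n<2^sb) 4Mℓ≤n n≤8Mℓ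
      (ℕₚ.≤-trans (ℕₚ.≤-reflexive (threshold-scale (3 + k₃) C E F (suc b + 2) E≡ F≡)) (subst (Z ≤_) (sym sM₁≡M) Z≤M))
    where
    open ℕₚ.≤-Reasoning
    instance
      4ℓ≢0 : NonZero (4 * ℓ)
      4ℓ≢0 = ℕₚ.m*n≢0 4 ℓ
      ℓᵗ⁻²≢0 : NonZero (ℓ ^ t₂)
      ℓᵗ⁻²≢0 = ℕₚ.m^n≢0 ℓ t₂
    Z M M₁ : ℕ
    Z = E * ((suc b + 2) * (suc b + 2))
    M = n / (4 * ℓ)
    -- No truncation occurs, since M ≥ Z ≥ 1; the cyclic arrangement needs `M` as a successor.
    M₁ = M ∸ 1
    b₀≤b : b₀ ≤ b
    b₀≤b = ℕₚ.≮⇒≥ λ b<b₀ → ℕₚ.<-irrefl refl (begin-strict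
      2 ^ suc b  ≤⟨ ℕₚ.^-monoʳ-≤ 2 b<b₀ ⟩
      2 ^ b₀     ≤⟨ 2^b₀≤n ⟩
      n          <⟨ n<2^sb ⟩
      2 ^ suc b  ∎)
    Z≤M : Z ≤ M
    Z≤M = many-colours n ℓ K Z
      (ℕₚ.≤-trans (ℕₚ.≤-trans (ℕₚ.m≤m*n (ℓ * ℓ) (ℓ ^ t₂)) (ℕₚ.≤-reflexive (ℕₚ.*-assoc ℓ ℓ (ℓ ^ t₂)))) ℓᵗ≤Kn)
      (begin
        16 * K * (Z * Z)     ≡⟨ square-scale K E D (suc b + 2) D≡ ⟩
        D * (suc b + 2) ^ 4  ≡⟨ cong (λ c → D * c ^ 4) (ℕₚ.+-suc b 2) ⟨
        D * (b + 3) ^ 4      ≤⟨ grows b b₀≤b ⟩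
        2 ^ b                ≤⟨ 2^b≤n ⟩
        n                    ∎)
    1≤Z : 1 ≤ Z
    1≤Z = ℕₚ.*-mono-≤ {1} {E} {1} (>-nonZero⁻¹ E) (ℕₚ.*-mono-≤ {1} {suc b + 2} {1} (s≤s z≤n) (s≤s z≤n))
    sM₁≡M : suc M₁ ≡ M
    sM₁≡M = ℕₚ.m+[n∸m]≡n (ℕₚ.≤-trans 1≤Z Z≤M)
    4Mℓ≤n : 4 * (suc M₁ * ℓ) ≤ n
    4Mℓ≤n = begin
      4 * (suc M₁ * ℓ)   ≡⟨ cong (λ m → 4 * (m * ℓ)) sM₁≡M ⟩
      4 * (M * ℓ)        ≡⟨ lemma M ℓ ⟩
      M * (4 * ℓ)        ≤⟨ m/n*n≤m n (4 * ℓ) ⟩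
      n                  ∎
      where
      lemma : ∀ m l → 4 * (m * l) ≡ m * (4 * l)
      lemma = solve-∀
    n≤8Mℓ : n ≤ 8 * (suc M₁ * ℓ)
    n≤8Mℓ = begin
      n                                ≡⟨ m≡m%n+[m/n]*n n (4 * ℓ) ⟩
      n % (4 * ℓ) + M * (4 * ℓ)        ≤⟨ ℕₚ.+-monoˡ-≤ (M * (4 * ℓ)) (ℕₚ.<⇒≤ (m%n<n n (4 * ℓ))) ⟩
      -- The remainder of the division is below 4 ℓ, and M ≥ 1 allows it to be absorbed by doubling.
      4 * ℓ + M * (4 * ℓ)              ≤⟨ ℕₚ.m≤m+n _ (4 * (M₁ * ℓ)) ⟩
      4 * ℓ + M * (4 * ℓ) + 4 * (M₁ * ℓ)  ≡⟨ cong (λ m → 4 * ℓ + m * (4 * ℓ) + 4 * (M₁ * ℓ)) (sym sM₁≡M) ⟩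
      4 * ℓ + suc M₁ * (4 * ℓ) + 4 * (M₁ * ℓ)  ≡⟨ lemma M₁ ℓ ⟩
      8 * (suc M₁ * ℓ)                 ∎
      where
      lemma : ∀ m l → 4 * l + suc m * (4 * l) + 4 * (m * l) ≡ 8 * (suc m * l)
      lemma = solve-∀

eventually : ∀ k₃ t₂ lam K .{{_ : NonZero lam}} .{{_ : NonZero K}} → suc t₂ ≤ k₃ →
  ∃[ N ] (∀ n .{{_ : NonZero n}} → N ≤ n → (S : PartialSystem n (3 + k₃) (2 + t₂) lam) →
    ∀ ℓ .{{_ : NonZero ℓ}} → ℓ ^ (2 + t₂) ≤ K * n → ∃[ φ ] CyclicallyGood S ℓ φ)
eventually k₃ t₂ lam K t₁≤k₃ = 2 ^ b₀ , λ n N≤n S ℓ ℓᵗ≤Kn →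
  large-systems k₃ t₂ lam K C E D _ b₀ (proj₁ (between-powers n)) refl refl refl refl (proj₂ (quartic≤exponential D)) t₁≤k₃
    n N≤n (proj₁ (proj₂ (between-powers n))) (proj₂ (proj₂ (between-powers n))) S ℓ ℓᵗ≤Kn
  where
  C E D b₀ : ℕ
  C = 8 * (lam * (K * 64 ^ suc t₂))
  E = 48 * ((3 + k₃) * (96 * ((3 + k₃) * C)))
  D = 16 * K * (E * E)
  b₀ = proj₁ (quartic≤exponential D)
  instance
    E≢0 : NonZero E
    E≢0 = ℕₚ.m*n≢0 48 ((3 + k₃) * (96 * ((3 + k₃) * C))) {{it}} {{ℕₚ.m*n≢0 (3 + k₃) (96 * ((3 + k₃) * C)) {{it}}
      {{ℕₚ.m*n≢0 96 ((3 + k₃) * C) {{it}} {{ℕₚ.m*n≢0 (3 + k₃) C {{it}} {{ℕₚ.m*n≢0 8 (lam * (K * 64 ^ suc t₂)) {{it}}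
      {{ℕₚ.m*n≢0 lam (K * 64 ^ suc t₂) {{it}} {{ℕₚ.m*n≢0 K (64 ^ suc t₂) {{it}} {{ℕₚ.m^n≢0 64 (suc t₂)}}}}}}}}}}}}}}

theorem2 : (k t lam : ℕ) → .{{_ : NonZero k}} → .{{_ : NonZero t}} → .{{_ : NonZero lam}} →
    (t+2≤k : t + 2 ≤ k) → 2 ≤ t →
    (α : ℝ⁺) → α <ᴿ threshold k t lam t+2≤k ^1/ t →
    ∃[ N ] ((n : ℕ) → .{{_ : NonZero n}} → N ≤ n →
    (S : PartialSystem n k t lam) →
    (ℓ : ℕ) → .{{_ : NonZero ℓ}} → fromℕ⁺ ℓ ≤ᴿ α *ᴿ fromℕ⁺ n ^1/ t →
    ∃[ φ ] CyclicallyGood S ℓ φ)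
theorem2 k zero           lam t+2≤k ()         α _
theorem2 k (suc zero)     lam t+2≤k (s≤s ())   α _
theorem2 k (suc (suc t₂)) lam t+2≤k _          α _ with subst (_≤ k) (ℕₚ.+-comm (2 + t₂) 2) t+2≤k
-- Removing three successors writes `k` as 3 + k₃ and turns t + 2 ≤ k into t - 1 ≤ k - 3.
... | s≤s (s≤s (s≤s t₁≤k₃)) =
  -- `K` depends only on α and `t`, so `N` is fixed before `n`, the system and `ℓ` are given.
  let K , K≢0 , ℓᵗ≤Kn = root-bound α (2 + t₂)
      N , large = eventually _ t₂ lam K {{it}} {{K≢0}} t₁≤k₃
  in N , λ n N≤n S ℓ ℓ≤ → large n N≤n S ℓ (ℓᵗ≤Kn n ℓ ℓ≤)
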